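{- Let $q$ be a prime power and let $f$ be the growth function $f=\log_q^2$, i.e. $f(q^k)=k^2$ for $k\ge1$, with $f(1)=1$. Let $$M_q(t,\log^2)=\Big\{\Theta(t)\in\mathbb{I}:\ \inf_{N(t)\in\mathbb{F}_q[t]\setminus\{0\}}f(|N(t)|)\cdot|N(t)|\cdot|\langle\Theta(t)\cdot N(t)\rangle|\cdot|N(t)|_{t}>0\Big\}$$ be the set of counterexamples to the $t$-adic Littlewood Conjecture with growth function $\log^2$. Then $M_q(t,\log^2)$ has full Hausdorff dimension: $$\dim M_q(t,\log^2)=1.$$
   Context: $\mathbb{F}_q$ is the finite field with $q$ elements and $\mathbb{F}_q((t^{ -1}))$ is the field of formal Laurent series $\Theta(t)=\sum_{i\ge -h}a_it^{ -i}$ over $\mathbb{F}_q$. If $a_{ -h}\ne0$ then $|\Theta(t)|=q^{h}$ (and $|0|=0$). The fractional part is $\langle\Theta(t)\rangle=\sum_{i\ge1}a_it^{ -i}$. The unit interval is $\mathbb{I}=\{\Theta\in\mathbb{F}_q((t^{ -1})):|\Theta|<1\}$. For nonzero $N(t)\in\mathbb{F}_q[t]$, $|N(t)|_t=q^{ -i}$ with $i=\max\{j\ge0:t^j\mid N(t)\}$. $\dim$ is Hausdorff dimension with respect to the metric $(\Theta,\Phi)\mapsto|\Theta-\Phi|$ on $\mathbb{F}_q((t^{ -1}))$. -}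

module Defs where

open import Algebra.Bundles using (CommutativeRing)
open import Axiom.ExcludedMiddle using (ExcludedMiddle)
open import Data.Empty using (⊥)
open import Data.Fin.Base using (Fin; toℕ)
import Data.Fin.Properties as Fin
open import Data.Integer.Base as ℤ using (ℤ; +_; -[1+_])
import Data.Integer.Properties as ℤ
open import Data.List.Base as List using (List; []; _∷_)
open import Data.Nat.Base as ℕ using (ℕ; zero; suc)
import Data.Nat.Properties as ℕ
open import Data.Nat.Primality using (Prime)
open import Data.Product using (Σ; ∃; ∃₂; ∃-syntax; _×_; _,_)
open import Data.Rational.Base as ℚ using (ℚ; 0ℚ; 1ℚ; _/_)
import Data.Rational.Properties as ℚ
open import Data.Sum.Base using (_⊎_; inj₁; inj₂)
open import Function.Bundles using (Inverse; _⇔_; mk⇔)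
open import Level using (Level; 0ℓ)
open import Relation.Binary.Definitions using (tri<; tri≈; tri>)
open import Relation.Binary.PropositionalEquality as ≡ using (_≡_)
open import Relation.Nullary using (¬_; yes; no)
open import Relation.Unary using (Pred)

import Algebra.Definitions.RawSemiring ℚ.+-*-rawSemiring as ℚ^

-- Two-sided Dedekind cuts.
record ℝ : Set₁ where
  field
    below         : ℚ → Set   -- below r : r < x
    above         : ℚ → Set   -- above r : x < r
    below-inhab   : ∃ below
    above-inhab   : ∃ above
    below-rounded : ∀ r → below r ⇔ (∃[ r′ ] (r ℚ.< r′ × below r′))
    above-rounded : ∀ r → above r ⇔ (∃[ r′ ] (r′ ℚ.< r × above r′))
    disjoint      : ∀ r → below r → above r → ⊥
    located       : ∀ r r′ → r ℚ.< r′ → below r ⊎ above r′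

open ℝ

infix 4 _≤ℝ_ _<ℝ_

_≤ℝ_ : ℝ → ℝ → Set
x ≤ℝ y = ∀ r → below x r → below y r

_<ℝ_ : ℝ → ℝ → Set
x <ℝ y = ∃[ r ] (above x r × below y r)

fromℚ : ℚ → ℝ
fromℚ x = record
  { below         = ℚ._< x
  ; above         = x ℚ.<_
  ; below-inhab   = x ℚ.- 1ℚ , below-x
  ; above-inhab   = x ℚ.+ 1ℚ , above-x
  ; below-rounded = λ r → mk⇔ (λ r<x → let m , r<m , m<x = ℚ.<-dense r<x in m , r<m , m<x)
                              (λ (_ , r<m , m<x) → ℚ.<-trans r<m m<x)
  ; above-rounded = λ r → mk⇔ (λ x<r → let m , x<m , m<r = ℚ.<-dense x<r in m , m<r , x<m)
                              (λ (_ , m<r , x<m) → ℚ.<-trans x<m m<r)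
  ; disjoint      = λ _ r<x x<r → ℚ.<-irrefl ≡.refl (ℚ.<-trans r<x x<r)
  ; located       = loc
  }
  where
  below-x : x ℚ.- 1ℚ ℚ.< x
  below-x = ≡.subst (x ℚ.- 1ℚ ℚ.<_) (ℚ.+-identityʳ x) (ℚ.+-monoʳ-< x (ℚ.negative⁻¹ (ℚ.- 1ℚ)))

  above-x : x ℚ.< x ℚ.+ 1ℚ
  above-x = ≡.subst (ℚ._< x ℚ.+ 1ℚ) (ℚ.+-identityʳ x) (ℚ.+-monoʳ-< x (ℚ.positive⁻¹ 1ℚ))

  loc : ∀ r r′ → r ℚ.< r′ → r ℚ.< x ⊎ x ℚ.< r′
  loc r r′ r<r′ with ℚ.<-cmp r x
  ... | tri< r<x _ _    = inj₁ r<x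
  ... | tri≈ _ ≡.refl _ = inj₂ r<r′
  ... | tri> _ _ x<r    = inj₂ (ℚ.<-trans x<r r<r′)

0ℝ 1ℝ : ℝ
0ℝ = fromℚ 0ℚ
1ℝ = fromℚ 1ℚ

IsInfimum : ∀ {a} → Pred ℝ a → ℝ → Set _
IsInfimum S x = (∀ s → S s → x ≤ℝ s) × (∀ y → (∀ s → S s → y ≤ℝ s) → y ≤ℝ x)

-- y ≤ x ^ s, for rational x, y ≥ 0 and real s > 0.  The exponent a / b
-- increases to s when x ≤ 1 and decreases to s when x ≥ 1, so that in
-- both cases x ^ s = inf x ^ (a / b); and y ≤ x ^ (a / b) means
-- y ^ b ≤ x ^ a.
_≤_^ℝ_ : ℚ → ℚ → ℝ → Set
y ≤ x ^ℝ s = ∀ a b .{{_ : ℕ.NonZero a}} .{{_ : ℕ.NonZero b}} →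
  (x ℚ.≤ 1ℚ × below s (+ a / b)) ⊎ (1ℚ ℚ.≤ x × above s (+ a / b)) →
  (y ℚ^.^ b) ℚ.≤ (x ℚ^.^ a)

-- Σᵢ (d i) ^ s ≤ r for d ≥ 0: all partial sums are bounded by r, each
-- term being the supremum of the rationals below it.
∑_^ℝ_≤_ : (ℕ → ℚ) → ℝ → ℚ → Set
∑ d ^ℝ s ≤ r = ∀ n (y : Fin n → ℚ) →
  (∀ i → 0ℚ ℚ.≤ y i × (y i ≤ d (toℕ i) ^ℝ s)) →
  ℚ^.sum y ℚ.≤ r

IsPrimePower : ℕ → Set
IsPrimePower q = ∃₂ λ p n → Prime p × 1 ℕ.≤ n × q ≡ p ℕ.^ n

record FiniteField (q : ℕ) : Set₁ where
  field
    commutativeRing : CommutativeRing 0ℓ 0ℓ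
  open CommutativeRing commutativeRing public
  field
    0≉1         : ¬ 0# ≈ 1#
    invertible  : ∀ x → ¬ x ≈ 0# → ∃[ y ] (x * y ≈ 1#)
    enumeration : Inverse setoid (≡.setoid (Fin q))

  q≢0 : ℕ.NonZero q
  q≢0 = Fin.nonZeroIndex (Inverse.to enumeration 0#)

-- The absolute value of an arbitrary series and the theory of Hausdorff
-- dimension are classical, so excluded middle is a parameter.
module Laurent {q : ℕ} (F : FiniteField q) (em : ExcludedMiddle 0ℓ) where

  private
    module F = FiniteField F
    open F using (_≈_; 0#) renaming (Carrier to 𝔽)
    open import Algebra.Definitions.RawMonoid F.+-rawMonoid using (sum)
    open import Algebra.Properties.Ring F.ring using (-0#≈0#)
    open import Algebra.Properties.Monoid.Sum F.+-monoid using (sum-cong-≋; sum-replicate-zero)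

    instance
      q-nonZero : ℕ.NonZero q
      q-nonZero = F.q≢0

  q^_ : ℤ → ℚ
  q^ (+ k)    = + (q ℕ.^ k) / 1
  q^ -[1+ k ] = _/_ (+ 1) (q ℕ.^ suc k) {{ℕ.m^n≢0 q (suc k)}}

  -- coeff i is the coefficient of t⁻ⁱ.
  record 𝕃 : Set where
    field
      coeff  : ℤ → 𝔽
      bound  : ℤ
      vanish : ∀ i → i ℤ.< ℤ.- bound → coeff i ≈ 0#

  open 𝕃 public

  HasLeadingExponent : 𝕃 → ℤ → Set
  HasLeadingExponent Θ h = ¬ coeff Θ (ℤ.- h) ≈ 0# × (∀ i → i ℤ.< ℤ.- h → coeff Θ i ≈ 0#)

  -- The second case is Θ = 0.
  ∣_∣ : 𝕃 → ℚ
  ∣ Θ ∣ with em {∃ (HasLeadingExponent Θ)}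
  ... | yes (h , _) = q^ h
  ... | no  _       = 0ℚ

  _⊖_ : 𝕃 → 𝕃 → 𝕃
  coeff  (Θ ⊖ Φ) i = coeff Θ i F.- coeff Φ i
  bound  (Θ ⊖ Φ)   = bound Θ ℤ.⊔ bound Φ
  vanish (Θ ⊖ Φ) i i<h = F.trans (F.+-cong Θᵢ≈0 (F.trans (F.-‿cong Φᵢ≈0) -0#≈0#)) (F.+-identityˡ 0#)
    where
    Θᵢ≈0 = vanish Θ i (ℤ.<-≤-trans i<h (ℤ.neg-mono-≤ (ℤ.i≤i⊔j (bound Θ) (bound Φ))))
    Φᵢ≈0 = vanish Φ i (ℤ.<-≤-trans i<h (ℤ.neg-mono-≤ (ℤ.i≤j⊔i (bound Θ) (bound Φ))))

  ⟨_⟩ : 𝕃 → 𝕃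
  coeff  ⟨ Θ ⟩ (+ suc i) = coeff Θ (+ suc i)
  coeff  ⟨ Θ ⟩ (+ zero)  = 0#
  coeff  ⟨ Θ ⟩ -[1+ _ ]  = 0#
  bound  ⟨ Θ ⟩           = + 0
  vanish ⟨ Θ ⟩ (+ _)    (ℤ.+<+ ())
  vanish ⟨ Θ ⟩ -[1+ _ ] _ = F.refl

  𝕀 : Pred 𝕃 0ℓ
  𝕀 Θ = ∣ Θ ∣ ℚ.< 1ℚ

  -- a₀ ∷ a₁ ∷ … is a₀ + a₁ t + …; trailing zeros are allowed.
  𝔽[t] : Set
  𝔽[t] = List 𝔽

  coeffₚ : 𝔽[t] → ℕ → 𝔽
  coeffₚ []      _       = 0#
  coeffₚ (a ∷ N) zero    = a
  coeffₚ (a ∷ N) (suc i) = coeffₚ N i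

  _≈ₚ_ : 𝔽[t] → 𝔽[t] → Set
  N ≈ₚ Q = ∀ i → coeffₚ N i ≈ coeffₚ Q i

  private
    coeffₚ-length : ∀ N i → List.length N ℕ.≤ i → coeffₚ N i ≈ 0#
    coeffₚ-length []      _       _            = F.refl
    coeffₚ-length (a ∷ N) (suc i) (ℕ.s≤s ∣N∣≤i) = coeffₚ-length N i ∣N∣≤i

  toSeries : 𝔽[t] → 𝕃
  coeff  (toSeries N) (+ zero)  = coeffₚ N 0
  coeff  (toSeries N) (+ suc _) = 0#
  coeff  (toSeries N) -[1+ i ]  = coeffₚ N (suc i)
  bound  (toSeries N)           = + List.length N
  vanish (toSeries [])      (+ _) (ℤ.+<+ ())
  vanish (toSeries (_ ∷ _)) (+ _) ()
  vanish (toSeries N) -[1+ i ] i<h =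
    coeffₚ-length N (suc i) (ℕ.<⇒≤ (ℤ.drop‿+<+ (ℤ.neg-cancel-< i<h)))

  -- The coefficient of t⁻ⁱ in Θ · Σⱼ nⱼ tʲ is Σⱼ nⱼ aᵢ₊ⱼ.
  _·_ : 𝕃 → 𝔽[t] → 𝕃
  coeff  (Θ · N) i = sum {List.length N} λ j → coeffₚ N (toℕ j) F.* coeff Θ (i ℤ.+ + toℕ j)
  bound  (Θ · N)   = bound Θ ℤ.+ + List.length N
  vanish (Θ · N) i i<h = F.trans (sum-cong-≋ term≈0) (sum-replicate-zero (List.length N))
    where
    shifted : ∀ j → i ℤ.+ + toℕ {List.length N} j ℤ.< ℤ.- bound Θ
    shifted j = ≡.subst (i ℤ.+ + toℕ j ℤ.<_) cancel
      (ℤ.+-mono-< i<h (ℤ.+<+ (Fin.toℕ<n j)))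
      where
      ℓ = + List.length N
      cancel : ℤ.- (bound Θ ℤ.+ ℓ) ℤ.+ ℓ ≡ ℤ.- bound Θ
      cancel = ≡.trans (≡.cong (ℤ._+ ℓ) (ℤ.neg-distrib-+ (bound Θ) ℓ))
        (≡.trans (ℤ.+-assoc (ℤ.- bound Θ) (ℤ.- ℓ) ℓ)
        (≡.trans (≡.cong (λ z → ℤ.- bound Θ ℤ.+ z) (ℤ.+-inverseˡ ℓ)) (ℤ.+-identityʳ _)))

    term≈0 : ∀ j → coeffₚ N (toℕ j) F.* coeff Θ (i ℤ.+ + toℕ {List.length N} j) ≈ 0#
    term≈0 j = F.trans (F.*-congˡ (vanish Θ _ (shifted j))) (F.zeroʳ _)

  t^_∣_ : ℕ → 𝔽[t] → Set
  t^ j ∣ N = ∃[ Q ] (N ≈ₚ (List.replicate j 0# List.++ Q))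

  IsOrder : 𝔽[t] → ℕ → Set
  IsOrder N i = t^ i ∣ N × (∀ j → t^ j ∣ N → j ℕ.≤ i)

  -- The second case is N = 0.
  ∣_∣ₜ : 𝔽[t] → ℚ
  ∣ N ∣ₜ with em {∃ (IsOrder N)}
  ... | yes (i , _) = q^ (ℤ.- + i)
  ... | no  _       = 0ℚ

  -- A growth function is only evaluated at powers q^k with k ≥ 0; g k is
  -- its value there, and other arguments are sent to 0.
  growth : (ℕ → ℚ) → ℚ → ℚ
  growth g x with em {∃[ k ] (x ≡ q^ (+ k))}
  ... | yes (k , _) = g k
  ... | no  _       = 0ℚ

  log² : ℚ → ℚ
  log² = growth λ where
    zero    → 1ℚ
    (suc k) → + (suc k ℕ.* suc k) / 1

  -- An infimum of rationals is positive iff they have a positive rational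
  -- lower bound.
  M : (ℚ → ℚ) → Pred 𝕃 0ℓ
  M f Θ = 𝕀 Θ × ∃[ c ] (0ℚ ℚ.< c × (∀ N → ¬ (N ≈ₚ []) →
    c ℚ.≤ f ∣ toSeries N ∣ ℚ.* ∣ toSeries N ∣ ℚ.* ∣ ⟨ Θ · N ⟩ ∣ ℚ.* ∣ N ∣ₜ))

  -- The diameter of U for the metric ∣ Θ ⊖ Φ ∣; that of a bounded set is
  -- rational, the distances lying in {0} ∪ q^ℤ, and ∅ has diameter 0.  U
  -- need not respect coefficientwise equality: closing it under that
  -- equality does not change its diameter.
  IsDiameter : Pred 𝕃 0ℓ → ℚ → Set
  IsDiameter U d = IsUpperBound d × (∀ e → IsUpperBound e → d ℚ.≤ e)
    where
    IsUpperBound : ℚ → Set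
    IsUpperBound e = 0ℚ ℚ.≤ e × (∀ Θ Φ → U Θ → U Φ → ∣ Θ ⊖ Φ ∣ ℚ.≤ e)

  record IsCover (δ : ℚ) (E : Pred 𝕃 0ℓ) (U : ℕ → Pred 𝕃 0ℓ) (d : ℕ → ℚ) : Set where
    field
      covers   : ∀ Θ → E Θ → ∃[ i ] U i Θ
      diameter : ∀ i → IsDiameter (U i) (d i)
      fine     : ∀ i → d i ℚ.≤ δ

  -- H^s(E) ≤ r, that is, inf { Σᵢ (diam Uᵢ)^s : U a δ-cover of E } ≤ r for
  -- every δ > 0.
  Hausdorff[_]_≤_ : ℝ → Pred 𝕃 0ℓ → ℚ → Set₁
  Hausdorff[ s ] E ≤ r = ∀ δ → 0ℚ ℚ.< δ → ∀ r′ → r ℚ.< r′ →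
    ∃₂ λ U d → IsCover δ E U d × (∑ d ^ℝ s ≤ r′)

  -- inf { s > 0 : H^s(E) = 0 } = D.  The value s = 0 does not affect the
  -- infimum, and leaving it out avoids the expression 0⁰.
  HausdorffDimension : Pred 𝕃 0ℓ → ℝ → Set₁
  HausdorffDimension E D = IsInfimum (λ s → 0ℝ <ℝ s × (Hausdorff[ s ] E ≤ 0ℚ)) D

{-# OPTIONS --safe #-}
-- Write Θ = ∑ xᵢ t⁻⁽ⁱ⁺¹⁾ and N = tʲ Q with deg Q = d and Q(0) ≠ 0.  If
-- ∣ ⟨ Θ · N ⟩ ∣ is too small, the block of x starting at j satisfies a linear
-- recurrence of order d on its first 2d + ℓ terms, with ℓ of order 2 log_q (j + d).
-- Once the first 2d terms of the block are known, such a block has only one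
-- possible continuation.  So after n digits, only n + 1 words of length
-- ℓ ≈ 2 log_q n are forbidden as continuations, one for each d ≤ n.
--
-- Give a forbidden word of remaining length l the weight γˡ with γ slightly
-- larger than 1/q.  Reading one more digit divides the total weight of the
-- forbidden words by γ q on average, which leaves room for the words added
-- at each step, and words of length ℓ ≈ 2 log_q n are light enough; so the
-- digits can be chosen one by one without ever completing a forbidden word.
-- The members of a cover with ∑ diam ^ s small, s < 1, are treated as further
-- forbidden words: the resulting Θ lies in M but in no set of the cover.
module Submission where

open import Defs
open import Algebra.Bundles using (CommutativeRing)
open import Axiom.ExcludedMiddle using (ExcludedMiddle)
open import Data.Empty using (⊥-elim)
open import Data.Fin.Base using (Fin; zero; suc; toℕ; fromℕ<; finToFun; funToFin)
import Data.Fin.Properties as Fin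
open import Data.Integer.Base as ℤ using (ℤ; +_; -[1+_])
import Data.Integer.Properties as ℤ
open import Data.List.Base as List using (List; []; _∷_; _++_; concatMap; length; upTo)
open import Data.List.Membership.Propositional using (_∈_)
open import Data.List.Membership.Propositional.Properties using (∈-++⁺ˡ; ∈-++⁺ʳ; ∈-concatMap⁺; ∈-upTo⁺)
open import Data.List.Properties using (∷-injectiveˡ; ∷-injectiveʳ; length-upTo)
open import Data.List.Relation.Unary.Any as Any using (here; there)
open import Data.Nat.Base as ℕ using (ℕ; zero; suc; z≤n; s≤s)
import Data.Nat.Properties as ℕ
open import Data.Nat.Tactic.RingSolver using (solve-∀)
open import Data.Product using (Σ; ∃; ∃-syntax; _×_; _,_; proj₁; proj₂)
open import Data.Rational.Base as ℚ using (ℚ; 0ℚ; 1ℚ; ½; _/_)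
import Data.Rational.Properties as ℚ
open import Data.Rational.Solver using (module +-*-Solver)
import Data.Rational.Unnormalised.Base as ℚᵘ
import Data.Rational.Unnormalised.Properties as ℚᵘ
open import Data.Sum.Base using (_⊎_; inj₁; inj₂)
open import Function.Base using (_∘_)
open import Function.Bundles using (Inverse; Equivalence)
open import Level using (0ℓ)
open import Relation.Binary.Definitions using (tri<; tri≈; tri>)
open import Relation.Binary.PropositionalEquality as ≡ using (_≡_; _≢_; refl; cong; cong₂; sym; trans; subst; subst₂)
open import Relation.Nullary using (¬_; yes; no)

open import Algebra.Properties.CommutativeSemiring.Exp (CommutativeRing.commutativeSemiring ℚ.+-*-commutativeRing)
  using (_^_; ^-homo-*; ^-assocʳ; ^-distrib-*)
import Algebra.Properties.Semiring.Sum (CommutativeRing.semiring ℚ.+-*-commutativeRing) as ℚ∑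

open ℝ

-- Arithmetic of rationals and powers

ι : ℕ → ℚ
ι n = + n / 1

private
  toℚᵘ-/ : ∀ i n .{{_ : ℕ.NonZero n}} → ℚ.toℚᵘ (i / n) ℚᵘ.≃ (i ℚᵘ./ n)
  toℚᵘ-/ i (suc n) = ℚ.toℚᵘ-fromℚᵘ (ℚᵘ.mkℚᵘ i n)

/-cancel-< : ∀ i j m n .{{_ : ℕ.NonZero m}} .{{_ : ℕ.NonZero n}} →
             i / m ℚ.< j / n → i ℤ.* + n ℤ.< j ℤ.* + m
/-cancel-< i j m@(suc _) n@(suc _) p = ℚᵘ.drop-*<*
  (ℚᵘ.<-respˡ-≃ (toℚᵘ-/ i m) (ℚᵘ.<-respʳ-≃ (toℚᵘ-/ j n) (ℚ.toℚᵘ-mono-< p)))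

/-mono-< : ∀ i j m n .{{_ : ℕ.NonZero m}} .{{_ : ℕ.NonZero n}} →
           i ℤ.* + n ℤ.< j ℤ.* + m → i / m ℚ.< j / n
/-mono-< i j m@(suc _) n@(suc _) p = ℚ.toℚᵘ-cancel-<
  (ℚᵘ.<-respˡ-≃ (ℚᵘ.≃-sym (toℚᵘ-/ i m)) (ℚᵘ.<-respʳ-≃ (ℚᵘ.≃-sym (toℚᵘ-/ j n)) (ℚᵘ.*<* p)))

ι-mono : ∀ {m n} → m ℕ.≤ n → ι m ℚ.≤ ι n
ι-mono {m} {n} m≤n = ℚ.toℚᵘ-cancel-≤
  (ℚᵘ.≤-respˡ-≃ (ℚᵘ.≃-sym (toℚᵘ-/ (+ m) 1)) (ℚᵘ.≤-respʳ-≃ (ℚᵘ.≃-sym (toℚᵘ-/ (+ n) 1))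
    (ℚᵘ.*≤* (ℤ.*-monoʳ-≤-nonNeg (+ 1) (ℤ.+≤+ m≤n)))))

ι-* : ∀ m n → ι (m ℕ.* n) ≡ ι m ℚ.* ι n
ι-* m n = ℚ.toℚᵘ-injective (begin
  ℚ.toℚᵘ (ι (m ℕ.* n))             ≈⟨ toℚᵘ-/ (+ (m ℕ.* n)) 1 ⟩
  ℚᵘ.mkℚᵘ (+ (m ℕ.* n)) 0          ≈⟨ ℚᵘ.*≡* (cong (ℤ._* + 1) (ℤ.pos-* m n)) ⟩
  ℚᵘ.mkℚᵘ (+ m) 0 ℚᵘ.* ℚᵘ.mkℚᵘ (+ n) 0   ≈⟨ ℚᵘ.*-cong (toℚᵘ-/ (+ m) 1) (toℚᵘ-/ (+ n) 1) ⟨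
  ℚ.toℚᵘ (ι m) ℚᵘ.* ℚ.toℚᵘ (ι n)   ≈⟨ ℚ.toℚᵘ-homo-* (ι m) (ι n) ⟨
  ℚ.toℚᵘ (ι m ℚ.* ι n)             ∎)
  where open ℚᵘ.≃-Reasoning

ι-+ : ∀ m n → ι (m ℕ.+ n) ≡ ι m ℚ.+ ι n
ι-+ m n = ℚ.toℚᵘ-injective (begin
  ℚ.toℚᵘ (ι (m ℕ.+ n))             ≈⟨ toℚᵘ-/ (+ (m ℕ.+ n)) 1 ⟩
  ℚᵘ.mkℚᵘ (+ (m ℕ.+ n)) 0          ≈⟨ ℚᵘ.*≡* (cong (ℤ._* + 1) (cong₂ ℤ._+_ (sym (ℤ.*-identityʳ (+ m))) (sym (ℤ.*-identityʳ (+ n))))) ⟩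
  ℚᵘ.mkℚᵘ (+ m) 0 ℚᵘ.+ ℚᵘ.mkℚᵘ (+ n) 0   ≈⟨ ℚᵘ.+-cong (toℚᵘ-/ (+ m) 1) (toℚᵘ-/ (+ n) 1) ⟨
  ℚ.toℚᵘ (ι m) ℚᵘ.+ ℚ.toℚᵘ (ι n)   ≈⟨ ℚ.toℚᵘ-homo-+ (ι m) (ι n) ⟨
  ℚ.toℚᵘ (ι m ℚ.+ ι n)             ∎)
  where open ℚᵘ.≃-Reasoning

ι-^ : ∀ m n → ι (m ℕ.^ n) ≡ ι m ^ n
ι-^ m zero    = refl
ι-^ m (suc n) = trans (ι-* m (m ℕ.^ n)) (cong (ι m ℚ.*_) (ι-^ m n))

ι-suc-* : ∀ n w → ι (suc n) ℚ.* w ≡ w ℚ.+ ι n ℚ.* w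
ι-suc-* n w = trans (cong (ℚ._* w) (ι-+ 1 n))
  (trans (ℚ.*-distribʳ-+ w 1ℚ (ι n)) (cong (ℚ._+ ι n ℚ.* w) (ℚ.*-identityˡ w)))

ι-mono-< : ∀ {m n} → m ℕ.< n → ι m ℚ.< ι n
ι-mono-< {m} {n} m<n = /-mono-< (+ m) (+ n) 1 1 (ℤ.*-monoʳ-<-pos (+ 1) (ℤ.+<+ m<n))

ι-injective : ∀ {m n} → ι m ≡ ι n → m ≡ n
ι-injective {m} {n} eq with ℕ.<-cmp m n
... | tri< m<n _ _ = ⊥-elim (ℚ.<-irrefl eq (ι-mono-< m<n))
... | tri≈ _ m≡n _ = m≡n
... | tri> _ _ n<m = ⊥-elim (ℚ.<-irrefl (sym eq) (ι-mono-< n<m))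

ι≥0 : ∀ n → 0ℚ ℚ.≤ ι n
ι≥0 n = ι-mono {0} {n} z≤n

ι>0 : ∀ n .{{_ : ℕ.NonZero n}} → 0ℚ ℚ.< ι n
ι>0 n@(suc _) = ℚ.<-≤-trans (ℚ.positive⁻¹ 1ℚ) (ι-mono {1} {n} (s≤s z≤n))

/-*-ι : ∀ m n .{{_ : ℕ.NonZero n}} → (+ m / n) ℚ.* ι n ≡ ι m
/-*-ι m n@(suc _) = ℚ.toℚᵘ-injective (begin
  ℚ.toℚᵘ ((+ m / n) ℚ.* ι n)             ≈⟨ ℚ.toℚᵘ-homo-* (+ m / n) (ι n) ⟩
  ℚ.toℚᵘ (+ m / n) ℚᵘ.* ℚ.toℚᵘ (ι n)     ≈⟨ ℚᵘ.*-cong (toℚᵘ-/ (+ m) n) (toℚᵘ-/ (+ n) 1) ⟩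
  (+ m ℚᵘ./ n) ℚᵘ.* (+ n ℚᵘ./ 1)         ≈⟨ ℚᵘ.*≡* (ℤ.*-assoc (+ m) (+ n) (+ 1)) ⟩
  + m ℚᵘ./ 1                             ≈⟨ toℚᵘ-/ (+ m) 1 ⟨
  ℚ.toℚᵘ (ι m)                           ∎)
  where open ℚᵘ.≃-Reasoning

/>0 : ∀ m n .{{_ : ℕ.NonZero m}} .{{_ : ℕ.NonZero n}} → 0ℚ ℚ.< + m / n
/>0 m n = ℚ.positive⁻¹ (+ m / n) {{ℚ.normalize-pos m n}}

*-mono-≤ : ∀ {a b c d} → 0ℚ ℚ.≤ a → a ℚ.≤ b → 0ℚ ℚ.≤ c → c ℚ.≤ d → a ℚ.* c ℚ.≤ b ℚ.* d
*-mono-≤ {a} {b} {c} {d} 0≤a a≤b 0≤c c≤d = ℚ.≤-trans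
  (ℚ.*-monoʳ-≤-nonNeg c {{ℚ.nonNegative 0≤c}} a≤b)
  (ℚ.*-monoˡ-≤-nonNeg b {{ℚ.nonNegative (ℚ.≤-trans 0≤a a≤b)}} c≤d)

*-monoˡ : ∀ {a b c} → 0ℚ ℚ.≤ c → a ℚ.≤ b → c ℚ.* a ℚ.≤ c ℚ.* b
*-monoˡ {c = c} 0≤c a≤b = ℚ.*-monoˡ-≤-nonNeg c {{ℚ.nonNegative 0≤c}} a≤b

*-monoʳ : ∀ {a b c} → 0ℚ ℚ.≤ c → a ℚ.≤ b → a ℚ.* c ℚ.≤ b ℚ.* c
*-monoʳ {c = c} 0≤c a≤b = ℚ.*-monoʳ-≤-nonNeg c {{ℚ.nonNegative 0≤c}} a≤b

*-cancelʳ : ∀ {a b c} → 0ℚ ℚ.< c → a ℚ.* c ℚ.≤ b ℚ.* c → a ℚ.≤ b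
*-cancelʳ {c = c} 0<c = ℚ.*-cancelʳ-≤-pos c {{ℚ.positive 0<c}}

*≥0 : ∀ {a b} → 0ℚ ℚ.≤ a → 0ℚ ℚ.≤ b → 0ℚ ℚ.≤ a ℚ.* b
*≥0 {a} {b} 0≤a 0≤b = ℚ.≤-trans (ℚ.≤-reflexive (sym (ℚ.*-zeroʳ a))) (*-monoˡ 0≤a 0≤b)

*>0 : ∀ {a b} → 0ℚ ℚ.< a → 0ℚ ℚ.< b → 0ℚ ℚ.< a ℚ.* b
*>0 {a} {b} 0<a 0<b = ℚ.positive⁻¹ (a ℚ.* b) {{ℚ.pos*pos⇒pos a {{ℚ.positive 0<a}} b {{ℚ.positive 0<b}}}}

^≥0 : ∀ {a} n → 0ℚ ℚ.≤ a → 0ℚ ℚ.≤ a ^ n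
^≥0 zero    _   = ℚ.nonNegative⁻¹ 1ℚ
^≥0 (suc n) 0≤a = *≥0 0≤a (^≥0 n 0≤a)

^>0 : ∀ {a} n → 0ℚ ℚ.< a → 0ℚ ℚ.< a ^ n
^>0 zero    _   = ℚ.positive⁻¹ 1ℚ
^>0 (suc n) 0<a = *>0 0<a (^>0 n 0<a)

^-monoˡ-≤ : ∀ {a b} n → 0ℚ ℚ.≤ a → a ℚ.≤ b → a ^ n ℚ.≤ b ^ n
^-monoˡ-≤ zero    _   _   = ℚ.≤-refl
^-monoˡ-≤ (suc n) 0≤a a≤b = *-mono-≤ 0≤a a≤b (^≥0 n 0≤a) (^-monoˡ-≤ n 0≤a a≤b)

^-monoˡ-< : ∀ {a b} n .{{_ : ℕ.NonZero n}} → 0ℚ ℚ.≤ a → a ℚ.< b → a ^ n ℚ.< b ^ n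
^-monoˡ-< {a} {b} (suc n) 0≤a a<b = ℚ.≤-<-trans
  (*-monoˡ 0≤a (^-monoˡ-≤ n 0≤a (ℚ.<⇒≤ a<b)))
  (ℚ.*-monoˡ-<-pos (b ^ n) {{ℚ.positive (^>0 n (ℚ.≤-<-trans 0≤a a<b))}} a<b)

^-cancelˡ-≤ : ∀ {a b} n .{{_ : ℕ.NonZero n}} → 0ℚ ℚ.≤ b → a ^ n ℚ.≤ b ^ n → a ℚ.≤ b
^-cancelˡ-≤ n 0≤b aⁿ≤bⁿ = ℚ.≮⇒≥ λ b<a → ℚ.<-irrefl refl (ℚ.<-≤-trans (^-monoˡ-< n 0≤b b<a) aⁿ≤bⁿ)

^-anti-≤ : ∀ {a m n} → 0ℚ ℚ.≤ a → a ℚ.≤ 1ℚ → m ℕ.≤ n → a ^ n ℚ.≤ a ^ m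
^-anti-≤ {n = zero}  0≤a a≤1 z≤n = ℚ.≤-refl
^-anti-≤ {n = suc n} 0≤a a≤1 z≤n = ℚ.≤-trans
  (*-mono-≤ 0≤a a≤1 (^≥0 n 0≤a) (^-anti-≤ {n = n} 0≤a a≤1 z≤n)) (ℚ.≤-reflexive (ℚ.*-identityˡ 1ℚ))
^-anti-≤ 0≤a a≤1 (s≤s m≤n) = *-monoˡ 0≤a (^-anti-≤ 0≤a a≤1 m≤n)

1^n≡1 : ∀ n → 1ℚ ^ n ≡ 1ℚ
1^n≡1 zero    = refl
1^n≡1 (suc n) = trans (ℚ.*-identityˡ _) (1^n≡1 n)

^-inverse : ∀ a b n → a ℚ.* b ≡ 1ℚ → a ^ n ℚ.* b ^ n ≡ 1ℚ
^-inverse a b n ab≡1 = trans (sym (^-distrib-* a b n)) (trans (cong (_^ n) ab≡1) (1^n≡1 n))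

∃-ι> : ∀ x → ∃[ n ] x ℚ.< ι n
∃-ι> x@(ℚ.mkℚ -[1+ n ] d _) = 0 , ℚ.negative⁻¹ x
∃-ι> x@(ℚ.mkℚ (+ n) d _) = suc n , subst (ℚ._< ι (suc n)) (ℚ.↥p/↧p≡p x)
  (/-mono-< (+ n) (+ suc n) (suc d) 1 (subst₂ ℤ._<_ (ℤ.pos-* n 1) (ℤ.pos-* (suc n) (suc d)) (ℤ.+<+ lt)))
  where
  lt : n ℕ.* 1 ℕ.< suc n ℕ.* suc d
  lt = s≤s (ℕ.≤-trans (ℕ.≤-reflexive (ℕ.*-identityʳ n)) (ℕ.≤-trans (ℕ.m≤m*n n (suc d)) (ℕ.m≤n+m (n ℕ.* suc d) d)))

-- Bernoulli's inequality (u/w)^k ≥ 1 - k/w for w = u + 1, cleared of denominators so that it stays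
-- in ℕ.
bernoulli : ∀ u k → suc u ℕ.^ k ℕ.* suc u ℕ.≤ u ℕ.^ k ℕ.* suc u ℕ.+ k ℕ.* suc u ℕ.^ k
bernoulli u zero    = ℕ.m≤m+n _ _
bernoulli u (suc k) = begin
  w ℕ.* X ℕ.* w                         ≡⟨ ℕ.*-assoc w X w ⟩
  w ℕ.* (X ℕ.* w)                       ≤⟨ ℕ.*-monoʳ-≤ w (bernoulli u k) ⟩
  w ℕ.* (Y ℕ.* w ℕ.+ k ℕ.* X)           ≡⟨ lem u k X Y ⟩
  u ℕ.* Y ℕ.* w ℕ.+ (w ℕ.* Y ℕ.+ k ℕ.* (w ℕ.* X)) ≤⟨ ℕ.+-monoʳ-≤ (u ℕ.* Y ℕ.* w) (ℕ.+-monoˡ-≤ (k ℕ.* (w ℕ.* X)) (ℕ.*-monoʳ-≤ w Y≤X)) ⟩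
  u ℕ.* Y ℕ.* w ℕ.+ (w ℕ.* X ℕ.+ k ℕ.* (w ℕ.* X)) ∎
  where
  open ℕ.≤-Reasoning
  w = suc u
  X = w ℕ.^ k
  Y = u ℕ.^ k
  Y≤X : Y ℕ.≤ X
  Y≤X = ℕ.^-monoˡ-≤ k (ℕ.n≤1+n u)
  lem : ∀ u k X Y → suc u ℕ.* (Y ℕ.* suc u ℕ.+ k ℕ.* X) ≡ u ℕ.* Y ℕ.* suc u ℕ.+ (suc u ℕ.* Y ℕ.+ k ℕ.* (suc u ℕ.* X))
  lem = solve-∀

-- For 2k ≤ w = u + 1, the error term k/w in Bernoulli's inequality is at most 1/2, so (u/w)^k ≥
-- 1/2. Doubling the inequality lets one copy of X w absorb both error terms.
suc-^-≤ : ∀ u k → 2 ℕ.* k ℕ.≤ suc u → suc u ℕ.^ k ℕ.≤ 2 ℕ.* u ℕ.^ k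
suc-^-≤ u k 2k≤w = ℕ.*-cancelʳ-≤ X (2 ℕ.* Y) w (ℕ.+-cancelʳ-≤ (X ℕ.* w) _ _ (begin
  X ℕ.* w ℕ.+ X ℕ.* w               ≤⟨ ℕ.+-mono-≤ (bernoulli u k) (bernoulli u k) ⟩
  Y ℕ.* w ℕ.+ k ℕ.* X ℕ.+ (Y ℕ.* w ℕ.+ k ℕ.* X)  ≡⟨ lem w k X Y ⟩
  2 ℕ.* Y ℕ.* w ℕ.+ X ℕ.* (2 ℕ.* k)   ≤⟨ ℕ.+-monoʳ-≤ (2 ℕ.* Y ℕ.* w) (ℕ.*-monoʳ-≤ X 2k≤w) ⟩
  2 ℕ.* Y ℕ.* w ℕ.+ X ℕ.* w ∎))
  where
  open ℕ.≤-Reasoning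
  w = suc u
  X = w ℕ.^ k
  Y = u ℕ.^ k
  lem : ∀ w k X Y → Y ℕ.* w ℕ.+ k ℕ.* X ℕ.+ (Y ℕ.* w ℕ.+ k ℕ.* X) ≡ 2 ℕ.* Y ℕ.* w ℕ.+ X ℕ.* (2 ℕ.* k)
  lem = solve-∀

∃-^-approx : ∀ q → 2 ℕ.≤ q → ∀ x → 1 ℕ.≤ x → ∃[ e ] (x ℕ.≤ q ℕ.^ e × q ℕ.^ e ℕ.≤ q ℕ.* x)
∃-^-approx q 2≤q (suc zero) _ = 0 , ℕ.≤-refl , ℕ.≤-trans (ℕ.<⇒≤ 2≤q) (ℕ.≤-reflexive (sym (ℕ.*-identityʳ q)))
∃-^-approx q 2≤q (suc (suc x)) _ with ∃-^-approx q 2≤q (suc x) (s≤s z≤n)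
... | e , lo , hi with suc (suc x) ℕ.≤? q ℕ.^ e
...   | yes p = e , p , ℕ.≤-trans hi (ℕ.*-monoʳ-≤ q (ℕ.n≤1+n _))
-- The exponent grows only when the old power has been overtaken, so the new power is less than q
-- times the new argument.
...   | no ¬p = suc e , lo′ , ℕ.*-monoʳ-≤ q (ℕ.<⇒≤ (ℕ.≰⇒> ¬p))
  where
  open ℕ.≤-Reasoning
  lo′ = begin
    suc (suc x)       ≤⟨ ℕ.m≤n+m (suc (suc x)) x ⟩
    x ℕ.+ suc (suc x) ≡⟨ ℕ.+-suc x (suc x) ⟩
    suc x ℕ.+ suc x   ≡⟨ cong (suc x ℕ.+_) (ℕ.+-identityʳ (suc x)) ⟨
    2 ℕ.* suc x       ≤⟨ ℕ.*-mono-≤ 2≤q lo ⟩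
    q ℕ.* q ℕ.^ e     ∎

-- The rate γ and the length of the forbidden words

ρ : (q : ℕ) .{{_ : ℕ.NonZero q}} → ℚ
ρ q = + 1 / q

ρ*ι≡1 : ∀ q .{{_ : ℕ.NonZero q}} → ρ q ℚ.* ι q ≡ 1ℚ
ρ*ι≡1 q = /-*-ι 1 q

ρ>0 : ∀ q .{{_ : ℕ.NonZero q}} → 0ℚ ℚ.< ρ q
ρ>0 q = />0 1 q

ρ≤1 : ∀ q .{{_ : ℕ.NonZero q}} → ρ q ℚ.≤ 1ℚ
ρ≤1 q = *-cancelʳ (ι>0 q) (ℚ.≤-trans (ℚ.≤-reflexive (ρ*ι≡1 q))
  (ℚ.≤-trans (ι-mono {1} (ℕ.>-nonZero⁻¹ q)) (ℚ.≤-reflexive (sym (ℚ.*-identityˡ (ι q))))))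

-- γ = (1 + 1/u) / q exceeds 1/q, yet γᵏ ≤ 2 q⁻ᵏ ≤ q¹⁻ᵏ as long as 2k ≤ u + 1.
module Rate (q : ℕ) .{{_ : ℕ.NonZero q}} (2≤q : 2 ℕ.≤ q) (u : ℕ) .{{_ : ℕ.NonZero u}} (3≤u : 3 ℕ.≤ u) where

  private instance
    2u≢0 : ℕ.NonZero (2 ℕ.* u)
    2u≢0 = ℕ.m*n≢0 2 u

  τ γ ε : ℚ
  τ = + suc u / u
  γ = ρ q ℚ.* τ
  ε = + 1 / (2 ℕ.* u)

  τ>0 : 0ℚ ℚ.< τ
  τ>0 = />0 (suc u) u

  γ>0 : 0ℚ ℚ.< γ
  γ>0 = *>0 (ρ>0 q) τ>0

  τ^k≤2 : ∀ k → 2 ℕ.* k ℕ.≤ suc u → τ ^ k ℚ.≤ ι 2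
  τ^k≤2 k 2k≤w = *-cancelʳ {τ ^ k} {ι 2} (^>0 k (ι>0 u)) (begin
    τ ^ k ℚ.* ι u ^ k    ≡⟨ ^-distrib-* τ (ι u) k ⟨
    (τ ℚ.* ι u) ^ k      ≡⟨ cong (_^ k) (/-*-ι (suc u) u) ⟩
    ι (suc u) ^ k        ≡⟨ ι-^ (suc u) k ⟨
    ι (suc u ℕ.^ k)      ≤⟨ ι-mono (suc-^-≤ u k 2k≤w) ⟩
    ι (2 ℕ.* u ℕ.^ k)    ≡⟨ ι-* 2 (u ℕ.^ k) ⟩
    ι 2 ℚ.* ι (u ℕ.^ k)  ≡⟨ cong (ι 2 ℚ.*_) (ι-^ u k) ⟩
    ι 2 ℚ.* ι u ^ k      ∎)
    where open ℚ.≤-Reasoning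

  γ^-≤ : ∀ k → 2 ℕ.* suc k ℕ.≤ suc u → γ ^ suc k ℚ.≤ ρ q ^ k
  γ^-≤ k 2k≤w = begin
    γ ^ suc k                            ≡⟨ ^-distrib-* (ρ q) τ (suc k) ⟩
    ρ q ^ suc k ℚ.* τ ^ suc k            ≤⟨ *-monoˡ (^≥0 (suc k) (ℚ.<⇒≤ (ρ>0 q))) (ℚ.≤-trans (τ^k≤2 (suc k) 2k≤w) (ι-mono 2≤q)) ⟩
    ρ q ℚ.* ρ q ^ k ℚ.* ι q              ≡⟨ solve 3 (λ a b c → a :* b :* c := a :* c :* b) refl (ρ q) (ρ q ^ k) (ι q) ⟩
    ρ q ℚ.* ι q ℚ.* ρ q ^ k              ≡⟨ cong (ℚ._* ρ q ^ k) (ρ*ι≡1 q) ⟩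
    1ℚ ℚ.* ρ q ^ k                       ≡⟨ ℚ.*-identityˡ _ ⟩
    ρ q ^ k                              ∎
    where
    open ℚ.≤-Reasoning
    open +-*-Solver

  ε<½ : ε ℚ.< ½
  ε<½ = /-mono-< (+ 1) (+ 1) (2 ℕ.* u) 2
    (subst (+ 2 ℤ.<_) (sym (ℤ.*-identityˡ (+ (2 ℕ.* u)))) (ℤ.+<+ (ℕ.*-monoʳ-< 2 {1} {u} (ℕ.<-≤-trans (s≤s (s≤s z≤n)) 3≤u))))

  ε+½<1 : ε ℚ.+ ½ ℚ.< 1ℚ
  ε+½<1 = ℚ.+-monoˡ-< ½ ε<½

  -- Since γ q = 1 + 1/u, the product γ q · ½ exceeds ½ by exactly 1/(2u) = ε. This is the room that
  -- one step of the greedy choice leaves for new words.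
  ε+½≤γq½ : ε ℚ.+ ½ ℚ.≤ γ ℚ.* (ι q ℚ.* ½)
  ε+½≤γq½ = *-cancelʳ (ι>0 (2 ℕ.* u)) (ℚ.≤-reflexive (begin
    (ε ℚ.+ ½) ℚ.* ι (2 ℕ.* u)                       ≡⟨ ℚ.*-distribʳ-+ (ι (2 ℕ.* u)) ε ½ ⟩
    ε ℚ.* ι (2 ℕ.* u) ℚ.+ ½ ℚ.* ι (2 ℕ.* u)         ≡⟨ cong₂ ℚ._+_ (/-*-ι 1 (2 ℕ.* u)) ½*ι2u ⟩
    ι 1 ℚ.+ ι u                                     ≡⟨ ι-+ 1 u ⟨
    ι (suc u)                                       ≡⟨ /-*-ι (suc u) u ⟨
    τ ℚ.* ι u                                       ≡⟨ cong (τ ℚ.*_) ½*ι2u ⟨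
    τ ℚ.* (½ ℚ.* ι (2 ℕ.* u))                       ≡⟨ ℚ.*-identityˡ _ ⟨
    1ℚ ℚ.* (τ ℚ.* (½ ℚ.* ι (2 ℕ.* u)))              ≡⟨ cong (ℚ._* (τ ℚ.* (½ ℚ.* ι (2 ℕ.* u)))) (ρ*ι≡1 q) ⟨
    ρ q ℚ.* ι q ℚ.* (τ ℚ.* (½ ℚ.* ι (2 ℕ.* u)))     ≡⟨ solve 5 (λ r i t h v → r :* i :* (t :* (h :* v)) := r :* t :* (i :* h) :* v) refl (ρ q) (ι q) τ ½ (ι (2 ℕ.* u)) ⟩
    γ ℚ.* (ι q ℚ.* ½) ℚ.* ι (2 ℕ.* u)               ∎))
    where
    open ≡.≡-Reasoning
    open +-*-Solver
    ½*ι2u : ½ ℚ.* ι (2 ℕ.* u) ≡ ι u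
    ½*ι2u = trans (cong (½ ℚ.*_) (ι-* 2 u)) (trans (sym (ℚ.*-assoc ½ (ι 2) (ι u))) (ℚ.*-identityˡ (ι u)))

  -- A length ℓ of order 2 log_q n: γ² ≤ 1/q turns q^(ℓ/2) ≥ 2u(n+2) into
  -- the summability bound, while q^ℓ is still quadratic in n.
  abstract
    ∃-length : ∀ n → ∃[ ℓ ] (ι (2 ℕ.+ n) ℚ.* γ ^ ℓ ℚ.≤ ε × q ℕ.^ ℓ ℕ.≤ (2 ℕ.* u ℕ.* q ℕ.* (2 ℕ.+ n)) ℕ.^ 2)
    ∃-length n with e , lo , hi ← ∃-^-approx q 2≤q (2 ℕ.* u ℕ.* (2 ℕ.+ n)) (ℕ.*-mono-≤ {1} (ℕ.>-nonZero⁻¹ (2 ℕ.* u)) (s≤s z≤n)) =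
      2 ℕ.* e , small , ℕ.≤-trans (ℕ.≤-reflexive (trans (cong (q ℕ.^_) (ℕ.*-comm 2 e)) (sym (ℕ.^-*-assoc q e 2)))) (ℕ.^-monoˡ-≤ 2
        (ℕ.≤-trans hi (ℕ.≤-reflexive (lem q (2 ℕ.* u) (2 ℕ.+ n)))))
      where
      lem : ∀ q v n → q ℕ.* (v ℕ.* n) ≡ v ℕ.* q ℕ.* n
      lem = solve-∀

      small : ι (2 ℕ.+ n) ℚ.* γ ^ (2 ℕ.* e) ℚ.≤ ε
      small = *-cancelʳ (ι>0 (2 ℕ.* u)) (begin
        ι (2 ℕ.+ n) ℚ.* γ ^ (2 ℕ.* e) ℚ.* ι (2 ℕ.* u)
          ≡⟨ solve 3 (λ a b c → a :* b :* c := b :* (c :* a)) refl (ι (2 ℕ.+ n)) (γ ^ (2 ℕ.* e)) (ι (2 ℕ.* u)) ⟩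
        γ ^ (2 ℕ.* e) ℚ.* (ι (2 ℕ.* u) ℚ.* ι (2 ℕ.+ n))
          ≡⟨ cong₂ ℚ._*_ (^-assocʳ γ 2 e) (ι-* (2 ℕ.* u) (2 ℕ.+ n)) ⟨
        (γ ^ 2) ^ e ℚ.* ι (2 ℕ.* u ℕ.* (2 ℕ.+ n))
          ≤⟨ *-mono-≤ (^≥0 e (^≥0 2 (ℚ.<⇒≤ γ>0))) (^-monoˡ-≤ e (^≥0 2 (ℚ.<⇒≤ γ>0)) γ²≤ρ) (ι≥0 (2 ℕ.* u ℕ.* (2 ℕ.+ n))) (ι-mono lo) ⟩
        ρ q ^ e ℚ.* ι (q ℕ.^ e)
          ≡⟨ cong (ρ q ^ e ℚ.*_) (ι-^ q e) ⟩
        ρ q ^ e ℚ.* ι q ^ e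
          ≡⟨ ^-inverse (ρ q) (ι q) e (ρ*ι≡1 q) ⟩
        1ℚ
          ≡⟨ /-*-ι 1 (2 ℕ.* u) ⟨
        ε ℚ.* ι (2 ℕ.* u) ∎)
        where
        open ℚ.≤-Reasoning
        open +-*-Solver
        γ²≤ρ : γ ^ 2 ℚ.≤ ρ q
        γ²≤ρ = ℚ.≤-trans (γ^-≤ 1 (s≤s 3≤u)) (ℚ.≤-reflexive (ℚ.*-identityʳ (ρ q)))

-- Finite sums and a pigeonhole principle

sum-mono : ∀ {n} {f g : Fin n → ℚ} → (∀ i → f i ℚ.≤ g i) → ℚ∑.sum f ℚ.≤ ℚ∑.sum g
sum-mono {zero}  f≤g = ℚ.≤-refl
sum-mono {suc n} f≤g = ℚ.+-mono-≤ (f≤g zero) (sum-mono (f≤g ∘ suc))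

sum≥0 : ∀ {n} {f : Fin n → ℚ} → (∀ i → 0ℚ ℚ.≤ f i) → 0ℚ ℚ.≤ ℚ∑.sum f
sum≥0 {n} 0≤f = ℚ.≤-trans (ℚ.≤-reflexive (sym (ℚ∑.sum-replicate-zero n))) (sum-mono 0≤f)

≤+ : ∀ {a b} → 0ℚ ℚ.≤ b → a ℚ.≤ a ℚ.+ b
≤+ {a} 0≤b = ℚ.≤-trans (ℚ.≤-reflexive (sym (ℚ.+-identityʳ a))) (ℚ.+-monoʳ-≤ a 0≤b)

+≤ : ∀ {a b} → 0ℚ ℚ.≤ b → a ℚ.≤ b ℚ.+ a
+≤ {a} 0≤b = ℚ.≤-trans (ℚ.≤-reflexive (sym (ℚ.+-identityˡ a))) (ℚ.+-monoˡ-≤ a 0≤b)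

term≤sum : ∀ {n} {f : Fin n → ℚ} → (∀ i → 0ℚ ℚ.≤ f i) → ∀ i → f i ℚ.≤ ℚ∑.sum f
term≤sum 0≤f zero    = ≤+ (sum≥0 (0≤f ∘ suc))
term≤sum 0≤f (suc i) = ℚ.≤-trans (term≤sum (0≤f ∘ suc) i) (+≤ (0≤f zero))

sum-single : ∀ {n} (f : Fin n → ℚ) i → (∀ j → j ≢ i → f j ≡ 0ℚ) → ℚ∑.sum f ≡ f i
sum-single {suc n} f zero f≡0 = trans
  (cong (f zero ℚ.+_) (trans (ℚ∑.sum-cong-≗ {n} (λ j → f≡0 (suc j) λ ())) (ℚ∑.sum-replicate-zero n)))
  (ℚ.+-identityʳ (f zero))
sum-single f (suc i) f≡0 = trans
  (cong₂ ℚ._+_ (f≡0 zero λ ()) (sum-single (f ∘ suc) i λ j j≢i → f≡0 (suc j) (j≢i ∘ Fin.suc-injective)))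
  (ℚ.+-identityˡ (f (suc i)))

∑< : (ℕ → ℚ) → ℕ → ℚ
∑< f n = ℚ∑.sum {n} (f ∘ toℕ)

∑<-mono : ∀ {f m n} → (∀ i → 0ℚ ℚ.≤ f i) → m ℕ.≤ n → ∑< f m ℚ.≤ ∑< f n
∑<-mono {f} {n = n} 0≤f z≤n = sum≥0 {n} (0≤f ∘ toℕ)
∑<-mono {f} 0≤f (s≤s m≤n) = ℚ.+-monoʳ-≤ (f 0) (∑<-mono (λ i → 0≤f (suc i)) m≤n)

term≤∑< : ∀ {f} → (∀ i → 0ℚ ℚ.≤ f i) → ∀ i → f i ℚ.≤ ∑< f (suc i)
term≤∑< {f} 0≤f i = subst (λ j → f j ℚ.≤ ∑< f (suc i)) (Fin.toℕ-fromℕ< (ℕ.n<1+n i))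
  (term≤sum {suc i} (0≤f ∘ toℕ) (fromℕ< (ℕ.n<1+n i)))

-- One x has to serve all n at once, and monotonicity provides it: if every `g x` exceeded B at some
-- stage, all would exceed it at a common later stage, and so would their mean.
pigeonhole-suc : ExcludedMiddle 0ℓ → ∀ k (g : Fin (suc k) → ℕ → ℚ) B →
  (∀ x {m n} → m ℕ.≤ n → g x m ℚ.≤ g x n) →
  (∀ n → ℚ∑.sum (λ x → g x n) ℚ.≤ ι (suc k) ℚ.* B) →
  ∃[ x ] (∀ n → g x n ℚ.≤ B)
pigeonhole-suc em zero g B mono bound = zero , λ n → subst₂ ℚ._≤_ (ℚ.+-identityʳ _) (ℚ.*-identityˡ B) (bound n)
pigeonhole-suc em (suc k) g B mono bound with em {∃[ N ] B ℚ.< g zero N}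
... | no ¬∃       = zero , λ n → ℚ.≮⇒≥ λ B<g → ¬∃ (n , B<g)
... | yes (N , B<g) =
  let x , x≤B = pigeonhole-suc em k (g ∘ suc) B (λ x → mono (suc x)) bound′ in suc x , x≤B
  where
  open ℚ.≤-Reasoning
  bound′ : ∀ n → ℚ∑.sum (λ x → g (suc x) n) ℚ.≤ ι (suc k) ℚ.* B
  bound′ n = ℚ.≮⇒≥ λ lt → ℚ.<-irrefl refl (begin-strict
    -- At stage n ⊔ N both the excess of `g zero`, known at N, and that of the remaining sum,
    -- assumed at n, are present.
    ι (suc (suc k)) ℚ.* B                      ≡⟨ ι-suc-* (suc k) B ⟩
    B ℚ.+ ι (suc k) ℚ.* B                      <⟨ ℚ.+-mono-< (ℚ.<-≤-trans B<g (mono zero (ℕ.m≤n⊔m n N)))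
                                                   (ℚ.<-≤-trans lt (sum-mono {suc k} λ x → mono (suc x) (ℕ.m≤m⊔n n N))) ⟩
    ℚ∑.sum (λ x → g x (n ℕ.⊔ N))                  ≤⟨ bound (n ℕ.⊔ N) ⟩
    ι (suc (suc k)) ℚ.* B                      ∎)

pigeonhole : ExcludedMiddle 0ℓ → ∀ q .{{_ : ℕ.NonZero q}} (g : Fin q → ℕ → ℚ) B →
  (∀ x {m n} → m ℕ.≤ n → g x m ℚ.≤ g x n) →
  (∀ n → ℚ∑.sum (λ x → g x n) ℚ.≤ ι q ℚ.* B) →
  ∃[ x ] (∀ n → g x n ℚ.≤ B)
pigeonhole em (suc k) = pigeonhole-suc em k

-- Greedy avoidance of words

-- The most recent letter comes first.
hist : {A : Set} → (ℕ → A) → ℕ → List A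
hist x zero    = []
hist x (suc n) = x n ∷ hist x n

seg : {A : Set} → (ℕ → A) → ℕ → ℕ → List A
seg x n zero    = []
seg x n (suc l) = x n ∷ seg x (suc n) l

module Greedy (em : ExcludedMiddle 0ℓ) (q : ℕ) .{{_ : ℕ.NonZero q}} {γ : ℚ} (0<γ : 0ℚ ℚ.< γ) where

  private
    A = Fin q
    Word = List A

    0≤γ = ℚ.<⇒≤ 0<γ

  Φ : List Word → ℚ
  Φ []      = 0ℚ
  Φ (u ∷ L) = γ ^ length u ℚ.+ Φ L

  Φ≥0 : ∀ L → 0ℚ ℚ.≤ Φ L
  Φ≥0 []      = ℚ.≤-refl
  Φ≥0 (u ∷ L) = ℚ.+-mono-≤ (^≥0 (length u) 0≤γ) (Φ≥0 L)

  Φ-++ : ∀ L L′ → Φ (L ++ L′) ≡ Φ L ℚ.+ Φ L′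
  Φ-++ []      L′ = sym (ℚ.+-identityˡ (Φ L′))
  Φ-++ (u ∷ L) L′ = trans (cong (γ ^ length u ℚ.+_) (Φ-++ L L′)) (sym (ℚ.+-assoc (γ ^ length u) (Φ L) (Φ L′)))

  ∈⇒^≤Φ : ∀ {u L} → u ∈ L → γ ^ length u ℚ.≤ Φ L
  ∈⇒^≤Φ {L = _ ∷ L} (here refl) = ≤+ (Φ≥0 L)
  ∈⇒^≤Φ {L = u ∷ _} (there u∈L) = ℚ.≤-trans (∈⇒^≤Φ u∈L) (+≤ (^≥0 (length u) 0≤γ))

  -- A word with another first letter can no longer be completed and is discarded. The empty word
  -- stands for a completed forbidden word; the bound on the potential keeps it from ever being
  -- pending.
  tailAt : A → Word → List Word
  tailAt x []      = []
  tailAt x (y ∷ u) with x Fin.≟ y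
  ... | yes _ = u ∷ []
  ... | no  _ = []

  ∂ : A → List Word → List Word
  ∂ x = concatMap (tailAt x)

  ∈-tailAt : ∀ x u → u ∈ tailAt x (x ∷ u)
  ∈-tailAt x u with x Fin.≟ x
  ... | yes _  = here refl
  ... | no x≢x = ⊥-elim (x≢x refl)

  ∈-∂ : ∀ {x u L} → (x ∷ u) ∈ L → u ∈ ∂ x L
  ∈-∂ {x} {u} (here refl) = ∈-++⁺ˡ (∈-tailAt x u)
  ∈-∂ {x} {L = v ∷ L} (there u∈L) = ∈-++⁺ʳ (tailAt x v) (∈-∂ u∈L)

  -- A nonempty word survives under exactly one letter, and losing that letter divides its weight by
  -- γ.
  Φ-tailAt : ∀ u → γ ℚ.* ℚ∑.sum (λ x → Φ (tailAt x u)) ℚ.≤ γ ^ length u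
  Φ-tailAt [] = ℚ.≤-trans
    (ℚ.≤-reflexive (trans (cong (γ ℚ.*_) (ℚ∑.sum-replicate-zero q)) (ℚ.*-zeroʳ γ))) (ℚ.nonNegative⁻¹ 1ℚ)
  Φ-tailAt (y ∷ u) = ℚ.≤-reflexive (cong (γ ℚ.*_)
    (trans (sum-single (λ x → Φ (tailAt x (y ∷ u))) y off) on))
    where
    off : ∀ x → x ≢ y → Φ (tailAt x (y ∷ u)) ≡ 0ℚ
    off x x≢y with x Fin.≟ y
    ... | yes x≡y = ⊥-elim (x≢y x≡y)
    ... | no _    = refl

    on : Φ (tailAt y (y ∷ u)) ≡ γ ^ length u
    on with y Fin.≟ y
    ... | yes _  = ℚ.+-identityʳ _
    ... | no y≢y = ⊥-elim (y≢y refl)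

  Φ-∂ : ∀ L → γ ℚ.* ℚ∑.sum (λ x → Φ (∂ x L)) ℚ.≤ Φ L
  Φ-∂ [] = ℚ.≤-reflexive (trans (cong (γ ℚ.*_) (ℚ∑.sum-replicate-zero q)) (ℚ.*-zeroʳ γ))
  Φ-∂ (u ∷ L) = begin
    γ ℚ.* ℚ∑.sum (λ x → Φ (tailAt x u ++ ∂ x L))
      ≡⟨ cong (γ ℚ.*_) (trans (ℚ∑.sum-cong-≗ (λ x → Φ-++ (tailAt x u) (∂ x L))) (ℚ∑.∑-distrib-+ (λ x → Φ (tailAt x u)) (λ x → Φ (∂ x L)))) ⟩
    γ ℚ.* (ℚ∑.sum (λ x → Φ (tailAt x u)) ℚ.+ ℚ∑.sum (λ x → Φ (∂ x L)))
      ≡⟨ ℚ.*-distribˡ-+ γ _ _ ⟩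
    γ ℚ.* ℚ∑.sum (λ x → Φ (tailAt x u)) ℚ.+ γ ℚ.* ℚ∑.sum (λ x → Φ (∂ x L))
      ≤⟨ ℚ.+-mono-≤ (Φ-tailAt u) (Φ-∂ L) ⟩
    γ ^ length u ℚ.+ Φ L ∎
    where open ℚ.≤-Reasoning

  -- Families of words are indexed by ℕ because the cover is infinite;
  -- the potential of such a family is bounded through its partial sums.
  total : (ℕ → List Word) → ℕ → ℚ
  total c = ∑< (Φ ∘ c)

  -- The words that become forbidden on the way form a finite list at each step, so all of them can
  -- join entry 0 of the family.
  add : List Word → (ℕ → List Word) → ℕ → List Word
  add L c zero    = L ++ c zero
  add L c (suc i) = c (suc i)

  ∈-add : ∀ L c i {u} → u ∈ c i → u ∈ add L c i
  ∈-add L c zero    = ∈-++⁺ʳ L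
  ∈-add L c (suc i) u∈ = u∈

  total-add : ∀ L c n → total (add L c) n ℚ.≤ Φ L ℚ.+ total c n
  total-add L c zero    = +≤ (Φ≥0 L)
  total-add L c (suc n) = ℚ.≤-reflexive (trans
    (cong (ℚ._+ ℚ∑.sum {n} (λ i → Φ (c (suc (toℕ i))))) (Φ-++ L (c 0))) (ℚ.+-assoc (Φ L) (Φ (c 0)) _))

  module _ {B ε : ℚ}
    (B+ε<1 : ε ℚ.+ B ℚ.< 1ℚ) (B+ε≤γqB : ε ℚ.+ B ℚ.≤ γ ℚ.* (ι q ℚ.* B))
    (G : List A → List Word) (ΦG≤ε : ∀ h → Φ (G h) ℚ.≤ ε)
    (c : ℕ → List Word) (total≤B : ∀ n → total c n ℚ.≤ B)
    where

    private
      -- `pending` consists of the remainders of those forbidden words that the letters in `past`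
      -- have matched so far. The bound B holds before the words of the current step are added, and
      -- ε + B afterwards.
      record State : Set where
        field
          past    : List A
          pending : ℕ → List Word
          bounded : ∀ n → total pending n ℚ.≤ B

        pending⁺ : ℕ → List Word
        pending⁺ = add (G past) pending

        bounded⁺ : ∀ n → total pending⁺ n ℚ.≤ ε ℚ.+ B
        bounded⁺ n = ℚ.≤-trans (total-add (G past) pending n) (ℚ.+-mono-≤ (ΦG≤ε past) (bounded n))

        choice : ∃[ x ] (∀ n → total (∂ x ∘ pending⁺) n ℚ.≤ B)
        -- Averaged over the q letters, the potential after the next letter is at most (ε + B) / (γ
        -- q) ≤ B, so some letter restores the bound B.
        choice = pigeonhole em q (λ x → total (∂ x ∘ pending⁺)) B
          (λ x → ∑<-mono (λ i → Φ≥0 (∂ x (pending⁺ i))))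
          (λ n → ℚ.*-cancelˡ-≤-pos γ {{ℚ.positive 0<γ}} (begin
            γ ℚ.* ℚ∑.sum (λ x → total (∂ x ∘ pending⁺) n)
              ≡⟨ cong (γ ℚ.*_) (ℚ∑.∑-comm {q} {n} (λ x i → Φ (∂ x (pending⁺ (toℕ i))))) ⟩
            γ ℚ.* ℚ∑.sum {n} (λ i → ℚ∑.sum (λ x → Φ (∂ x (pending⁺ (toℕ i)))))
              ≡⟨ ℚ∑.*-distribˡ-sum {n} γ _ ⟩
            ℚ∑.sum {n} (λ i → γ ℚ.* ℚ∑.sum (λ x → Φ (∂ x (pending⁺ (toℕ i)))))
              ≤⟨ sum-mono {n} (λ i → Φ-∂ (pending⁺ (toℕ i))) ⟩
            total pending⁺ n
              ≤⟨ bounded⁺ n ⟩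
            ε ℚ.+ B
              ≤⟨ B+ε≤γqB ⟩
            γ ℚ.* (ι q ℚ.* B) ∎))
          where open ℚ.≤-Reasoning

      open State

      next : State → State
      next S = record { past = proj₁ (choice S) ∷ past S
                      ; pending = ∂ (proj₁ (choice S)) ∘ pending⁺ S
                      ; bounded = proj₂ (choice S) }

      state : ℕ → State
      state zero    = record { past = [] ; pending = c ; bounded = total≤B }
      state (suc n) = next (state n)

      path : ℕ → A
      path n = proj₁ (choice (state n))

      past≡hist : ∀ n → past (state n) ≡ hist path n
      past≡hist zero    = refl
      past≡hist (suc n) = cong (path n ∷_) (past≡hist n)

      -- A forbidden word that the path followed would shrink letter by letter to the empty word,
      -- whose weight 1 exceeds the bound ε + B on the whole potential.
      avoid : ∀ n i u → u ∈ pending⁺ (state n) i → u ≢ seg path n (length u)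
      avoid n i [] u∈ _ = ℚ.<-irrefl refl (ℚ.≤-<-trans (∈⇒^≤Φ u∈) (ℚ.≤-<-trans
        (term≤∑< (λ j → Φ≥0 (pending⁺ (state n) j)) i) (ℚ.≤-<-trans (bounded⁺ (state n) (suc i)) B+ε<1)))
      avoid n i (y ∷ u) u∈ eq = avoid (suc n) i u
        (∈-add (G (past (state (suc n)))) (pending (state (suc n))) i
          (∈-∂ (subst (λ z → (z ∷ u) ∈ pending⁺ (state n) i) (∷-injectiveˡ eq) u∈)))
        (∷-injectiveʳ eq)

    greedy : ∃[ x ] (∀ n {u} → u ∈ G (hist x n) → u ≢ seg x n (length u))
                  × (∀ i {u} → u ∈ c i → u ≢ seg x 0 (length u))
    greedy = path
      , (λ n {u} u∈ → avoid n 0 u (∈-++⁺ˡ (subst (λ h → u ∈ G h) (sym (past≡hist n)) u∈)))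
      , (λ i {u} u∈ → avoid 0 i u (∈-add (G []) c i u∈))

-- Absolute values of Laurent series

module Norm {q : ℕ} (F : FiniteField q) (em : ExcludedMiddle 0ℓ) where
  open Laurent F em
  private module F = FiniteField F
  open import Algebra.Properties.Group F.+-group using () renaming (x∙y⁻¹≈ε⇒x≈y to x-y≈0⇒x≈y)

  instance
    q≢0 : ℕ.NonZero q
    q≢0 = F.q≢0

  from : Fin q → F.Carrier
  from = Inverse.from F.enumeration

  from-injective : ∀ {x y} → from x F.≈ from y → x ≡ y
  from-injective {x} {y} p = trans (sym (Inverse.strictlyInverseˡ F.enumeration x))
    (trans (Inverse.to-cong F.enumeration p) (Inverse.strictlyInverseˡ F.enumeration y))

  2≤q : 2 ℕ.≤ q
  2≤q = Fin.injective⇒≤ {f = two} inj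
    where
    to = Inverse.to F.enumeration
    two : Fin 2 → Fin q
    two zero       = to F.0#
    two (suc _)    = to F.1#
    sep : to F.0# ≢ to F.1#
    sep p = F.0≉1 (F.trans (F.sym (Inverse.strictlyInverseʳ F.enumeration F.0#))
      (F.trans (F.reflexive (cong from p)) (Inverse.strictlyInverseʳ F.enumeration F.1#)))
    inj : ∀ {i j} → two i ≡ two j → i ≡ j
    inj {zero}     {zero}     _ = refl
    inj {zero}     {suc zero} p = ⊥-elim (sep p)
    inj {suc zero} {zero}     p = ⊥-elim (sep (sym p))
    inj {suc zero} {suc zero} _ = refl

  0≤ρ : 0ℚ ℚ.≤ ρ q
  0≤ρ = ℚ.<⇒≤ (ρ>0 q)

  ρ^-anti : ∀ {m n} → m ℕ.≤ n → ρ q ^ n ℚ.≤ ρ q ^ m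
  ρ^-anti = ^-anti-≤ 0≤ρ (ρ≤1 q)

  q^-neg : ∀ k → q^ (ℤ.- + k) ≡ ρ q ^ k
  q^-neg zero    = refl
  q^-neg (suc k) = ℚ.≤-antisym (*-cancelʳ 0<N (ℚ.≤-reflexive eq)) (*-cancelʳ 0<N (ℚ.≤-reflexive (sym eq)))
    where
    instance
      N≢0 : ℕ.NonZero (q ℕ.^ suc k)
      N≢0 = ℕ.m^n≢0 q (suc k)
    0<N = ι>0 (q ℕ.^ suc k)
    eq : q^ -[1+ k ] ℚ.* ι (q ℕ.^ suc k) ≡ ρ q ^ suc k ℚ.* ι (q ℕ.^ suc k)
    eq = trans (/-*-ι 1 (q ℕ.^ suc k)) (trans (sym (^-inverse (ρ q) (ι q) (suc k) (ρ*ι≡1 q)))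
      (cong (ρ q ^ suc k ℚ.*_) (sym (ι-^ q (suc k)))))

  q^-mono : ∀ {a b} → a ℤ.≤ b → q^ a ℚ.≤ q^ b
  q^-mono (ℤ.+≤+ {m} {n} m≤n) = ι-mono (ℕ.^-monoʳ-≤ q m≤n)
  q^-mono (ℤ.-≤+ {m} {n}) = ℚ.≤-trans (ℚ.≤-reflexive (q^-neg (suc m)))
    (ℚ.≤-trans (ρ^-anti {0} {suc m} z≤n) (ι-mono {1} (ℕ.m^n>0 q n)))
  q^-mono (ℤ.-≤- {m} {n} n≤m) = subst₂ ℚ._≤_ (sym (q^-neg (suc m))) (sym (q^-neg (suc n))) (ρ^-anti (s≤s n≤m))

  q^>0 : ∀ a → 0ℚ ℚ.< q^ a
  q^>0 (+ k)    = ι>0 (q ℕ.^ k) {{ℕ.m^n≢0 q k}}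
  q^>0 -[1+ k ] = subst (0ℚ ℚ.<_) (sym (q^-neg (suc k))) (^>0 (suc k) (ρ>0 q))

  -- The coefficients vanish below -`bound`, so scanning upwards from there and deciding each one by
  -- `em` meets the leading coefficient first.
  leading-search : ∀ Θ n → (∀ i → i ℤ.< ℤ.- bound Θ ℤ.+ + n → coeff Θ i F.≈ F.0#) ⊎ ∃ (HasLeadingExponent Θ)
  leading-search Θ zero = inj₁ λ i i<b → vanish Θ i (subst (i ℤ.<_) (ℤ.+-identityʳ _) i<b)
  leading-search Θ (suc n) with leading-search Θ n
  ... | inj₂ lead = inj₂ lead
  ... | inj₁ low with em {coeff Θ (ℤ.- bound Θ ℤ.+ + n) F.≈ F.0#}
  ...   | no  Θₙ≉0 = inj₂ (ℤ.- z , subst (λ w → ¬ coeff Θ w F.≈ F.0#) (sym (ℤ.neg-involutive z)) Θₙ≉0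
                                 , λ i i<h → low i (subst (i ℤ.<_) (ℤ.neg-involutive z) i<h))
    where z = ℤ.- bound Θ ℤ.+ + n
  ...   | yes Θₙ≈0 = inj₁ step
    where
    z = ℤ.- bound Θ ℤ.+ + n
    z+1 : ℤ.- bound Θ ℤ.+ + suc n ≡ ℤ.suc z
    z+1 = trans (ℤ.+-comm (ℤ.- bound Θ) (+ suc n))
      (trans (ℤ.+-assoc (+ 1) (+ n) (ℤ.- bound Θ)) (cong ℤ.suc (ℤ.+-comm (+ n) (ℤ.- bound Θ))))
    step : ∀ i → i ℤ.< ℤ.- bound Θ ℤ.+ + suc n → coeff Θ i F.≈ F.0#
    step i i< with ℤ.<-cmp i z
    ... | tri< i<z _ _    = low i i<z
    ... | tri≈ _ refl _ = Θₙ≈0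
    ... | tri> _ _ z<i    = ⊥-elim (ℤ.<-irrefl refl (ℤ.≤-<-trans (ℤ.i<j⇒suc[i]≤j z<i) (subst (i ℤ.<_) z+1 i<)))

  ≉0⇒leading : ∀ Θ z → ¬ coeff Θ z F.≈ F.0# → ∃ (HasLeadingExponent Θ)
  -- This many steps carry the scan past z, wherever z lies relative to the bound.
  ≉0⇒leading Θ z Θ≉0 with leading-search Θ (suc ℤ.∣ z ℤ.+ bound Θ ∣)
  ... | inj₂ lead = lead
  ... | inj₁ low  = ⊥-elim (Θ≉0 (low z (subst (ℤ._< ℤ.- bound Θ ℤ.+ + suc ℤ.∣ z ℤ.+ bound Θ ∣) cancel
      (ℤ.+-monoʳ-< (ℤ.- bound Θ) (i<suc∣i∣ (z ℤ.+ bound Θ))))))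
    where
    i<suc∣i∣ : ∀ i → i ℤ.< + suc ℤ.∣ i ∣
    i<suc∣i∣ (+ n)    = ℤ.+<+ (ℕ.n<1+n n)
    i<suc∣i∣ -[1+ n ] = ℤ.-<+
    cancel : ℤ.- bound Θ ℤ.+ (z ℤ.+ bound Θ) ≡ z
    cancel = trans (cong (λ w → ℤ.- bound Θ ℤ.+ w) (ℤ.+-comm z (bound Θ)))
      (trans (sym (ℤ.+-assoc (ℤ.- bound Θ) (bound Θ) z))
      (trans (cong (ℤ._+ z) (ℤ.+-inverseˡ (bound Θ))) (ℤ.+-identityˡ z)))

  leading-≤ : ∀ {Θ h z} → HasLeadingExponent Θ h → ¬ coeff Θ z F.≈ F.0# → ℤ.- z ℤ.≤ h
  leading-≤ {h = h} {z} (_ , low) Θ≉0 = ℤ.≮⇒≥ λ h<-z → Θ≉0 (low z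
    (subst (ℤ._< ℤ.- h) (ℤ.neg-involutive z) (ℤ.neg-mono-< h<-z)))

  ∣∣-lower : ∀ Θ z → ¬ coeff Θ z F.≈ F.0# → q^ (ℤ.- z) ℚ.≤ ∣ Θ ∣
  ∣∣-lower Θ z Θ≉0 with em {∃ (HasLeadingExponent Θ)}
  ... | yes (h , lead) = q^-mono (leading-≤ {Θ} lead Θ≉0)
  ... | no ¬lead       = ⊥-elim (¬lead (≉0⇒leading Θ z Θ≉0))

  ∣∣-upper : ∀ Θ h → (∀ i → i ℤ.< ℤ.- h → coeff Θ i F.≈ F.0#) → ∣ Θ ∣ ℚ.≤ q^ h
  ∣∣-upper Θ h low with em {∃ (HasLeadingExponent Θ)}
  ... | no _                = ℚ.<⇒≤ (q^>0 h)
  ... | yes (h′ , Θ≉0 , _)  = q^-mono (ℤ.≮⇒≥ λ h<h′ → Θ≉0 (low (ℤ.- h′) (ℤ.neg-mono-< h<h′)))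

  ∣∣-leading : ∀ Θ h → HasLeadingExponent Θ h → ∣ Θ ∣ ≡ q^ h
  ∣∣-leading Θ h (Θ≉0 , low) = ℚ.≤-antisym (∣∣-upper Θ h low)
    (subst (λ z → q^ z ℚ.≤ ∣ Θ ∣) (ℤ.neg-involutive h) (∣∣-lower Θ (ℤ.- h) Θ≉0))

  series : (ℕ → F.Carrier) → 𝕃
  coeff  (series a) (+ suc i) = a i
  coeff  (series a) (+ zero)  = F.0#
  coeff  (series a) -[1+ _ ]  = F.0#
  bound  (series a)           = + 0
  vanish (series a) (+ _)    (ℤ.+<+ ())
  vanish (series a) -[1+ _ ] _ = F.refl

  series∈𝕀 : ∀ a → 𝕀 (series a)
  series∈𝕀 a = ℚ.≤-<-trans (∣∣-upper (series a) (ℤ.- + 1) low) q⁻¹<1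
    where
    low : ∀ i → i ℤ.< + 1 → coeff (series a) i F.≈ F.0#
    low (+ zero)  _ = F.refl
    low (+ suc _) (ℤ.+<+ (s≤s ()))
    low -[1+ _ ]  _ = F.refl
    q⁻¹<1 : q^ (ℤ.- + 1) ℚ.< 1ℚ
    q⁻¹<1 = subst₂ ℚ._<_ (sym (trans (q^-neg 1) (ℚ.*-identityʳ (ρ q)))) refl
      (/-mono-< (+ 1) (+ 1) q 1 (subst (+ 1 ℤ.<_) (sym (ℤ.*-identityˡ (+ q))) (ℤ.+<+ 2≤q)))

  -- Different digits at i < m would put the two series at distance at least q^-(i+1) ≥ q^-m.
  agree : ∀ (x y : ℕ → Fin q) {d} m → ∣ series (from ∘ x) ⊖ series (from ∘ y) ∣ ℚ.≤ d → d ℚ.< ρ q ^ m →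
          ∀ i → i ℕ.< m → x i ≡ y i
  agree x y {d} m ∣x-y∣≤d d<ρᵐ i i<m with x i Fin.≟ y i
  ... | yes xᵢ≡yᵢ = xᵢ≡yᵢ
  ... | no  xᵢ≢yᵢ = ⊥-elim (ℚ.<-irrefl refl (begin-strict
    ρ q ^ m                                        ≤⟨ ρ^-anti i<m ⟩
    ρ q ^ suc i                                    ≡⟨ q^-neg (suc i) ⟨
    q^ (ℤ.- + suc i)                               ≤⟨ ∣∣-lower (series (from ∘ x) ⊖ series (from ∘ y)) (+ suc i) (xᵢ≢yᵢ ∘ from-injective ∘ x-y≈0⇒x≈y _ _) ⟩
    ∣ series (from ∘ x) ⊖ series (from ∘ y) ∣      ≤⟨ ∣x-y∣≤d ⟩
    d                                              <⟨ d<ρᵐ ⟩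
    ρ q ^ m                                        ∎))
    where open ℚ.≤-Reasoning

-- Linear recurrences

module Recurrence {a ℓ} (R : CommutativeRing a ℓ) where
  open CommutativeRing R renaming (Carrier to C; refl to ≈-refl; sym to ≈-sym; trans to ≈-trans)
  open import Algebra.Properties.Semiring.Sum semiring
  open import Relation.Binary.Reasoning.Setoid setoid

  -- N relations of order d bind d + N consecutive terms; N = d + l therefore reaches l terms beyond
  -- the first 2d.
  Recurrent : ∀ {d} → (Fin d → C) → (ℕ → C) → ℕ → ℕ → Set ℓ
  Recurrent {d} Q s j N = ∀ r → r ℕ.< N →
    s (j ℕ.+ (r ℕ.+ d)) ≈ sum {d} (λ i → Q i * s (j ℕ.+ (r ℕ.+ toℕ i)))

  -- The operators sending a sequence to its forecast under Q and under Q′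
  -- commute, so both recurrences predict the same next term.
  recurrent-unique : ∀ {d} (Q Q′ : Fin d → C) s s′ j l →
    Recurrent Q s j (d ℕ.+ l) → Recurrent Q′ s′ j (d ℕ.+ l) →
    (∀ i → i ℕ.< d ℕ.+ d → s (j ℕ.+ i) ≈ s′ (j ℕ.+ i)) →
    ∀ e → e ℕ.≤ l → ∀ i → i ℕ.< d ℕ.+ d ℕ.+ e → s (j ℕ.+ i) ≈ s′ (j ℕ.+ i)
  recurrent-unique {d} Q Q′ s s′ j l rec rec′ same zero    _   i i< = same i (≡.subst (i ℕ.<_) (ℕ.+-identityʳ (d ℕ.+ d)) i<)
  recurrent-unique {d} Q Q′ s s′ j l rec rec′ same (suc e) e<l i i<
    with ℕ.m≤n⇒m<n∨m≡n (ℕ.s≤s⁻¹ (≡.subst (i ℕ.<_) (ℕ.+-suc (d ℕ.+ d) e) i<))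
  ... | inj₁ i<2d+e = recurrent-unique Q Q′ s s′ j l rec rec′ same e (ℕ.<⇒≤ e<l) i i<2d+e
  ... | inj₂ refl = begin
    s (j ℕ.+ (d ℕ.+ d ℕ.+ e))
      ≡⟨ ≡.cong (λ k → s (j ℕ.+ k)) (shuffle d d e) ⟩
    s (j ℕ.+ (d ℕ.+ e ℕ.+ d))
      ≈⟨ rec (d ℕ.+ e) (ℕ.+-monoʳ-< d e<l) ⟩
    sum {d} (λ i → Q i * s (j ℕ.+ (d ℕ.+ e ℕ.+ toℕ i)))
      -- The terms entering the forecast under Q have index d + e or more, so each is itself
      -- forecast by Q′ from known terms. This double forecast is what requires 2d initial terms.
      ≈⟨ sum-cong-≋ {d} (λ i → *-congˡ (≈-trans (IH (d ℕ.+ e ℕ.+ toℕ i) (lt₁ i)) (≈-trans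
           (reflexive (≡.cong (λ k → s′ (j ℕ.+ k)) (shuffle′ d e (toℕ i))))
           (rec′ (e ℕ.+ toℕ i) (lt₂ i))))) ⟩
    sum {d} (λ i → Q i * sum {d} (λ k → Q′ k * s′ (j ℕ.+ (e ℕ.+ toℕ i ℕ.+ toℕ k))))
      ≈⟨ sum-cong-≋ {d} (λ i → *-distribˡ-sum {d} (Q i) _) ⟩
    sum {d} (λ i → sum {d} (λ k → Q i * (Q′ k * s′ (j ℕ.+ (e ℕ.+ toℕ i ℕ.+ toℕ k)))))
      ≈⟨ ∑-comm {d} {d} (λ i k → Q i * (Q′ k * s′ (j ℕ.+ (e ℕ.+ toℕ i ℕ.+ toℕ k)))) ⟩
    sum {d} (λ k → sum {d} (λ i → Q i * (Q′ k * s′ (j ℕ.+ (e ℕ.+ toℕ i ℕ.+ toℕ k)))))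
      ≈⟨ sum-cong-≋ {d} (λ k → sum-cong-≋ {d} (λ i → swap k i)) ⟩
    sum {d} (λ k → sum {d} (λ i → Q′ k * (Q i * s (j ℕ.+ (e ℕ.+ toℕ k ℕ.+ toℕ i)))))
      ≈⟨ sum-cong-≋ {d} (λ k → *-distribˡ-sum {d} (Q′ k) _) ⟨
    sum {d} (λ k → Q′ k * sum {d} (λ i → Q i * s (j ℕ.+ (e ℕ.+ toℕ k ℕ.+ toℕ i))))
      ≈⟨ sum-cong-≋ {d} (λ k → *-congˡ (≈-trans (≈-sym (rec (e ℕ.+ toℕ k) (lt₂ k))) (≈-trans
           (reflexive (≡.cong (λ m → s (j ℕ.+ m)) (≡.sym (shuffle′ d e (toℕ k)))))
           (IH (d ℕ.+ e ℕ.+ toℕ k) (lt₁ k))))) ⟩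
    sum {d} (λ k → Q′ k * s′ (j ℕ.+ (d ℕ.+ e ℕ.+ toℕ k)))
      ≈⟨ rec′ (d ℕ.+ e) (ℕ.+-monoʳ-< d e<l) ⟨
    s′ (j ℕ.+ (d ℕ.+ e ℕ.+ d))
      ≡⟨ ≡.cong (λ k → s′ (j ℕ.+ k)) (shuffle d d e) ⟨
    s′ (j ℕ.+ (d ℕ.+ d ℕ.+ e)) ∎
    where
    IH = recurrent-unique Q Q′ s s′ j l rec rec′ same e (ℕ.<⇒≤ e<l)

    shuffle : ∀ a b c → a ℕ.+ b ℕ.+ c ≡ a ℕ.+ c ℕ.+ b
    shuffle a b c = ≡.trans (ℕ.+-assoc a b c) (≡.trans (≡.cong (a ℕ.+_) (ℕ.+-comm b c)) (≡.sym (ℕ.+-assoc a c b)))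

    shuffle′ : ∀ a b c → a ℕ.+ b ℕ.+ c ≡ b ℕ.+ c ℕ.+ a
    shuffle′ a b c = ≡.trans (ℕ.+-assoc a b c) (ℕ.+-comm a (b ℕ.+ c))

    lt₁ : ∀ (i : Fin d) → d ℕ.+ e ℕ.+ toℕ i ℕ.< d ℕ.+ d ℕ.+ e
    lt₁ i = ≡.subst (d ℕ.+ e ℕ.+ toℕ i ℕ.<_) (≡.sym (shuffle d d e)) (ℕ.+-monoʳ-< (d ℕ.+ e) (Fin.toℕ<n i))

    lt₂ : ∀ (i : Fin d) → e ℕ.+ toℕ i ℕ.< d ℕ.+ l
    lt₂ i = ≡.subst (e ℕ.+ toℕ i ℕ.<_) (ℕ.+-comm l d) (ℕ.+-mono-≤-< (ℕ.<⇒≤ e<l) (Fin.toℕ<n i))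

    lt₃ : ∀ (k i : Fin d) → e ℕ.+ toℕ k ℕ.+ toℕ i ℕ.< d ℕ.+ d ℕ.+ e
    lt₃ k i = ≡.subst₂ ℕ._<_
      (≡.trans (ℕ.+-comm (toℕ k ℕ.+ toℕ i) e) (≡.sym (ℕ.+-assoc e (toℕ k) (toℕ i)))) ≡.refl
      (ℕ.+-monoˡ-< e (ℕ.+-mono-< (Fin.toℕ<n k) (Fin.toℕ<n i)))

    swap : ∀ k i → Q i * (Q′ k * s′ (j ℕ.+ (e ℕ.+ toℕ i ℕ.+ toℕ k))) ≈ Q′ k * (Q i * s (j ℕ.+ (e ℕ.+ toℕ k ℕ.+ toℕ i)))
    swap k i = begin
      Q i * (Q′ k * s′ (j ℕ.+ (e ℕ.+ toℕ i ℕ.+ toℕ k)))  ≡⟨ ≡.cong (λ m → Q i * (Q′ k * s′ (j ℕ.+ m))) (shuffle e (toℕ i) (toℕ k)) ⟩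
      Q i * (Q′ k * s′ (j ℕ.+ (e ℕ.+ toℕ k ℕ.+ toℕ i)))  ≈⟨ *-congˡ (*-congˡ (IH (e ℕ.+ toℕ k ℕ.+ toℕ i) (lt₃ k i))) ⟨
      Q i * (Q′ k * s (j ℕ.+ (e ℕ.+ toℕ k ℕ.+ toℕ i)))   ≈⟨ *-assoc _ _ _ ⟨
      Q i * Q′ k * s (j ℕ.+ (e ℕ.+ toℕ k ℕ.+ toℕ i))     ≈⟨ *-congʳ (*-comm _ _) ⟩
      Q′ k * Q i * s (j ℕ.+ (e ℕ.+ toℕ k ℕ.+ toℕ i))     ≈⟨ *-assoc _ _ _ ⟩
      Q′ k * (Q i * s (j ℕ.+ (e ℕ.+ toℕ k ℕ.+ toℕ i)))   ∎

-- Forbidden words from recurrent blocks and from points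

length-hist : ∀ {A : Set} (x : ℕ → A) n → length (hist x n) ≡ n
length-hist x zero    = refl
length-hist x (suc n) = cong suc (length-hist x n)

hist-agree : ∀ {A : Set} {x y : ℕ → A} n → hist x n ≡ hist y n → ∀ i → i ℕ.< n → x i ≡ y i
hist-agree (suc n) eq i i<1+n with ℕ.m≤n⇒m<n∨m≡n (ℕ.s≤s⁻¹ i<1+n)
... | inj₁ i<n  = hist-agree n (∷-injectiveʳ eq) i i<n
... | inj₂ refl = ∷-injectiveˡ eq

length-seg : ∀ {A : Set} (x : ℕ → A) n l → length (seg x n l) ≡ l
length-seg x n zero    = refl
length-seg x n (suc l) = cong suc (length-seg x (suc n) l)

seg-cong : ∀ {A : Set} {x y : ℕ → A} n l → (∀ i → i ℕ.< l → x (n ℕ.+ i) ≡ y (n ℕ.+ i)) → seg x n l ≡ seg y n l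
seg-cong n zero    same = refl
seg-cong {x = x} {y} n (suc l) same = cong₂ _∷_
  (subst (λ k → x k ≡ y k) (ℕ.+-identityʳ n) (same 0 (s≤s z≤n)))
  (seg-cong (suc n) l λ i i<l → subst (λ k → x k ≡ y k) (ℕ.+-suc n i) (same (suc i) (s≤s i<l)))

∈-concatMap : ∀ {A : Set} {f : ℕ → List A} {d ds u} → d ∈ ds → u ∈ f d → u ∈ concatMap f ds
∈-concatMap {f = f} d∈ds u∈fd = ∈-concatMap⁺ f (Any.map (λ d≡e → subst (λ e → _ ∈ f e) d≡e u∈fd) d∈ds)

module Construction {q : ℕ} (F : FiniteField q) (em : ExcludedMiddle 0ℓ)
  {γ ε : ℚ} (γ>0 : 0ℚ ℚ.< γ) (ε+½<1 : ε ℚ.+ ½ ℚ.< 1ℚ) (ε+½≤γq½ : ε ℚ.+ ½ ℚ.≤ γ ℚ.* (ι q ℚ.* ½))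
  (ℓ : ℕ → ℕ) (ℓ-large : ∀ n → ι (2 ℕ.+ n) ℚ.* γ ^ ℓ n ℚ.≤ ε) where
  open Norm F em
  open Greedy em q γ>0
  open Recurrence (FiniteField.commutativeRing F)
  private
    A = Fin q
    Word = List A

  Bad : List A → ℕ → Set
  Bad h d = ∃[ s ] ∃[ Q ] (hist s (length h) ≡ h ×
    Recurrent {d} Q (from ∘ s) (length h ℕ.∸ (d ℕ.+ d)) (d ℕ.+ ℓ (length h)))

  -- Any witness s will do: by `recurrent-unique` the last 2d letters of h determine the next ℓ
  -- letters, even between witnesses with different coefficients Q. Hence one word per order d
  -- suffices.
  block : List A → ℕ → List Word
  block h d with em {Bad h d}
  ... | yes (s , _) = seg s (length h) (ℓ (length h)) ∷ []
  ... | no _        = []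

  Φ-block : ∀ h d → Φ (block h d) ℚ.≤ γ ^ ℓ (length h)
  Φ-block h d with em {Bad h d}
  ... | yes (s , _) = ℚ.≤-reflexive (trans (ℚ.+-identityʳ _) (cong (γ ^_) (length-seg s (length h) (ℓ (length h)))))
  ... | no _        = ^≥0 (ℓ (length h)) (ℚ.<⇒≤ γ>0)

  ∈-block : ∀ h d x (Q : Fin d → _) → d ℕ.+ d ℕ.≤ length h → hist x (length h) ≡ h →
    Recurrent Q (from ∘ x) (length h ℕ.∸ (d ℕ.+ d)) (d ℕ.+ ℓ (length h)) →
    seg x (length h) (ℓ (length h)) ∈ block h d
  ∈-block h d x Q 2d≤n x≡h rec with em {Bad h d}
  ... | no ¬bad = ⊥-elim (¬bad (x , Q , x≡h , rec))
  ... | yes (s , Q′ , s≡h , rec′) = here (seg-cong n l λ i i<l →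
    subst (λ k → x k ≡ s k) (shift i) (from-injective
      (recurrent-unique Q Q′ (from ∘ x) (from ∘ s) j l rec rec′ same l ℕ.≤-refl (d ℕ.+ d ℕ.+ i) (ℕ.+-monoʳ-< (d ℕ.+ d) i<l))))
    where
    n = length h
    l = ℓ n
    j = n ℕ.∸ (d ℕ.+ d)
    j+2d≡n : j ℕ.+ (d ℕ.+ d) ≡ n
    j+2d≡n = ℕ.m∸n+n≡m 2d≤n
    shift : ∀ i → j ℕ.+ (d ℕ.+ d ℕ.+ i) ≡ n ℕ.+ i
    shift i = trans (sym (ℕ.+-assoc j (d ℕ.+ d) i)) (cong (ℕ._+ i) j+2d≡n)
    same : ∀ i → i ℕ.< d ℕ.+ d → FiniteField._≈_ F (from (x (j ℕ.+ i))) (from (s (j ℕ.+ i)))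
    same i i<2d = FiniteField.reflexive F (cong from (hist-agree n (trans x≡h (sym s≡h)) (j ℕ.+ i)
      (subst (j ℕ.+ i ℕ.<_) j+2d≡n (ℕ.+-monoʳ-< j i<2d))))

  Φ-concatMap : ∀ {f : ℕ → List Word} {w} → (∀ d → Φ (f d) ℚ.≤ w) → ∀ ds → Φ (concatMap f ds) ℚ.≤ ι (length ds) ℚ.* w
  Φ-concatMap {w = w} f≤w [] = ℚ.≤-reflexive (sym (ℚ.*-zeroˡ w))
  Φ-concatMap {f} {w} f≤w (d ∷ ds) = begin
    Φ (f d ++ concatMap f ds)            ≡⟨ Φ-++ (f d) (concatMap f ds) ⟩
    Φ (f d) ℚ.+ Φ (concatMap f ds)       ≤⟨ ℚ.+-mono-≤ (f≤w d) (Φ-concatMap f≤w ds) ⟩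
    w ℚ.+ ι (length ds) ℚ.* w            ≡⟨ ι-suc-* (length ds) w ⟨
    ι (suc (length ds)) ℚ.* w            ∎
    where open ℚ.≤-Reasoning

  module _ (points : ℕ → ℕ → A) where

    -- The first word is a diagonal argument: at step n the sequence is made to leave the n-th point
    -- within the next ℓ letters. With one word for each order d ≤ n this gives at most n + 2 words,
    -- the factor in `ℓ-large`.
    forbidden : List A → List Word
    forbidden h = seg (points (length h)) (length h) (ℓ (length h)) ∷ concatMap (block h) (upTo (suc (length h)))

    Φ-forbidden : ∀ h → Φ (forbidden h) ℚ.≤ ε
    Φ-forbidden h = begin
      γ ^ length (seg (points n) n (ℓ n)) ℚ.+ Φ (concatMap (block h) (upTo (suc n)))
        ≤⟨ ℚ.+-mono-≤ (ℚ.≤-reflexive (cong (γ ^_) (length-seg (points n) n (ℓ n)))) (Φ-concatMap {block h} (Φ-block h) (upTo (suc n))) ⟩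
      γ ^ ℓ n ℚ.+ ι (length (upTo (suc n))) ℚ.* γ ^ ℓ n
        ≡⟨ cong (λ k → γ ^ ℓ n ℚ.+ ι k ℚ.* γ ^ ℓ n) (length-upTo (suc n)) ⟩
      γ ^ ℓ n ℚ.+ ι (suc n) ℚ.* γ ^ ℓ n
        ≡⟨ ι-suc-* (suc n) (γ ^ ℓ n) ⟨
      ι (2 ℕ.+ n) ℚ.* γ ^ ℓ n
        ≤⟨ ℓ-large n ⟩
      ε ∎
      where
      open ℚ.≤-Reasoning
      n = length h

    module _ {x : ℕ → A} (avoids : ∀ n {v} → v ∈ forbidden (hist x n) → v ≢ seg x n (length v)) where

      avoids-seg : ∀ n l → ¬ seg x n l ∈ forbidden (hist x n)
      avoids-seg n l ∈f = avoids n ∈f (cong (seg x n) (sym (length-seg x n l)))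

      ¬point : ∀ n → ¬ (∀ i → points n i ≡ x i)
      ¬point n same = avoids-seg n (ℓ n) (here (subst (λ m → seg x n (ℓ n) ≡ seg (points m) m (ℓ m))
        (sym (length-hist x n)) (sym (seg-cong n (ℓ n) λ i _ → same (n ℕ.+ i)))))

      ¬recurrent : ∀ j {d} (Q : Fin d → _) → ¬ Recurrent Q (from ∘ x) j (d ℕ.+ ℓ (j ℕ.+ (d ℕ.+ d)))
      ¬recurrent j {d} Q rec = avoids-seg n (ℓ n) (there (∈-concatMap {f = block h} d≤n seg∈block))
        where
        -- The block starting at j is caught when its first 2d terms have just been read.
        n = j ℕ.+ (d ℕ.+ d)
        h = hist x n

        len : n ≡ length h
        len = sym (length-hist x n)

        d≤n : d ∈ upTo (suc (length h))
        d≤n = ∈-upTo⁺ (s≤s (subst (d ℕ.≤_) len (ℕ.≤-trans (ℕ.m≤m+n d d) (ℕ.m≤n+m (d ℕ.+ d) j))))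

        RecurrentFrom : ℕ → ℕ → Set
        RecurrentFrom k m = Recurrent Q (from ∘ x) k (d ℕ.+ ℓ m)

        rec′ : RecurrentFrom (length h ℕ.∸ (d ℕ.+ d)) (length h)
        rec′ = subst (λ m → RecurrentFrom (m ℕ.∸ (d ℕ.+ d)) m) len
          (subst (λ k → RecurrentFrom k n) (sym (ℕ.m+n∸n≡m j (d ℕ.+ d))) rec)

        seg∈block : seg x n (ℓ n) ∈ block h d
        seg∈block = subst (λ m → seg x m (ℓ m) ∈ block h d) (sym len)
          (∈-block h d x Q (subst (d ℕ.+ d ℕ.≤_) len (ℕ.m≤n+m (d ℕ.+ d) j)) (cong (hist x) (sym len)) rec′)

    construct : (c : ℕ → List Word) → (∀ n → total c n ℚ.≤ ½) →
      ∃[ x ] ((∀ j {d} (Q : Fin d → _) → ¬ Recurrent Q (from ∘ x) j (d ℕ.+ ℓ (j ℕ.+ (d ℕ.+ d))))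
            × (∀ n → ¬ (∀ i → points n i ≡ x i))
            × (∀ i {v} → v ∈ c i → v ≢ seg x 0 (length v)))
    construct c c≤½ =
      let x , avoids , avoids-c = greedy ε+½<1 ε+½≤γq½ forbidden Φ-forbidden c c≤½
      in x , ¬recurrent avoids , ¬point avoids , avoids-c

-- Sequences without long recurrences lie in M

module Polynomials {q : ℕ} (F : FiniteField q) (em : ExcludedMiddle 0ℓ) where
  open Norm F em public
  open Laurent F em
  private module F = FiniteField F

  -- N = t^low · Q with Q(0) ≠ 0 and deg Q = span.
  record Extent (N : 𝔽[t]) : Set where
    field
      low span : ℕ
      low≉0    : ¬ coeffₚ N low F.≈ F.0#
      top≉0    : ¬ coeffₚ N (low ℕ.+ span) F.≈ F.0#
      below≈0  : ∀ i → i ℕ.< low → coeffₚ N i F.≈ F.0#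
      above≈0  : ∀ i → low ℕ.+ span ℕ.< i → coeffₚ N i F.≈ F.0#
      top<len  : low ℕ.+ span ℕ.< length N

  extent : ∀ N → ¬ (N ≈ₚ []) → Extent N
  extent []      N≉0 = ⊥-elim (N≉0 λ _ → F.refl)
  extent (a ∷ N) aN≉0 with em {N ≈ₚ []} | em {a F.≈ F.0#}
  ... | yes N≈0 | yes a≈0 = ⊥-elim (aN≉0 λ { zero → a≈0 ; (suc i) → N≈0 i })
  ... | yes N≈0 | no  a≉0 = record
    { low = 0 ; span = 0 ; low≉0 = a≉0 ; top≉0 = a≉0
    ; below≈0 = λ _ () ; above≈0 = λ { (suc i) _ → N≈0 i } ; top<len = s≤s z≤n }
  ... | no  N≉0 | yes a≈0 = record
    { low = suc low ; span = span ; low≉0 = low≉0 ; top≉0 = top≉0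
    ; below≈0 = λ { zero _ → a≈0 ; (suc i) (s≤s i<j) → below≈0 i i<j }
    ; above≈0 = λ { (suc i) (s≤s k<i) → above≈0 i k<i } ; top<len = s≤s top<len }
    where open Extent (extent N N≉0)
  ... | no  N≉0 | no  a≉0 = record
    { low = 0 ; span = suc (low ℕ.+ span) ; low≉0 = a≉0 ; top≉0 = top≉0
    ; below≈0 = λ _ () ; above≈0 = λ { (suc i) (s≤s k<i) → above≈0 i k<i } ; top<len = s≤s top<len }
    where open Extent (extent N N≉0)

  coeffₚ-drop : ∀ j N → (∀ i → i ℕ.< j → coeffₚ N i F.≈ F.0#) → N ≈ₚ (List.replicate j F.0# ++ List.drop j N)
  coeffₚ-drop zero    N       N≈0 i       = F.refl
  coeffₚ-drop (suc j) []      N≈0 zero    = F.refl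
  coeffₚ-drop (suc j) []      N≈0 (suc i) = F.trans (coeffₚ-drop j [] (λ _ _ → F.refl) i)
    (F.reflexive (cong (λ L → coeffₚ (List.replicate j F.0# ++ L) i) (drop-[] j)))
    where
    drop-[] : ∀ j → List.drop {A = F.Carrier} j [] ≡ []
    drop-[] zero    = refl
    drop-[] (suc j) = refl
  coeffₚ-drop (suc j) (a ∷ N) N≈0 zero    = N≈0 0 (s≤s z≤n)
  coeffₚ-drop (suc j) (a ∷ N) N≈0 (suc i) = coeffₚ-drop j N (λ i i<j → N≈0 (suc i) (s≤s i<j)) i

  coeffₚ-replicate : ∀ j Q i → i ℕ.< j → coeffₚ (List.replicate j F.0# ++ Q) i F.≈ F.0#
  coeffₚ-replicate (suc j) Q zero    _         = F.refl
  coeffₚ-replicate (suc j) Q (suc i) (s≤s i<j) = coeffₚ-replicate j Q i i<j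

  module _ {N : 𝔽[t]} (E : Extent N) where
    open Extent E

    ∣toSeries∣ : ∣ toSeries N ∣ ≡ q^ (+ (low ℕ.+ span))
    ∣toSeries∣ = ∣∣-leading (toSeries N) (+ (low ℕ.+ span))
      ( (λ N≈0 → top≉0 (F.trans (F.reflexive (coeff-neg (low ℕ.+ span))) N≈0)) , vanishing (low ℕ.+ span) above≈0)
      where
      coeff-neg : ∀ k → coeffₚ N k ≡ coeff (toSeries N) (ℤ.- + k)
      coeff-neg zero    = refl
      coeff-neg (suc k) = refl
      vanishing : ∀ k → (∀ i → k ℕ.< i → coeffₚ N i F.≈ F.0#) → ∀ i → i ℤ.< ℤ.- + k → coeff (toSeries N) i F.≈ F.0#
      vanishing zero    N≈0 (+ m)      (ℤ.+<+ ())
      vanishing zero    N≈0 -[1+ m ]   _            = N≈0 (suc m) (s≤s z≤n)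
      vanishing (suc k) N≈0 -[1+ m ]   (ℤ.-<- k<m)  = N≈0 (suc m) (s≤s k<m)

    isOrder : IsOrder N low
    isOrder = (List.drop low N , coeffₚ-drop low N below≈0)
            , λ { j (Q , N≈tʲQ) → ℕ.≮⇒≥ λ low<j → low≉0 (F.trans (N≈tʲQ low) (coeffₚ-replicate j Q low low<j)) }

    ∣∣ₜ≡ : ∣ N ∣ₜ ≡ ρ q ^ low
    ∣∣ₜ≡ with em {∃ (IsOrder N)}
    ... | yes (i , div , max) = trans (q^-neg i) (cong (ρ q ^_) (ℕ.≤-antisym (proj₂ isOrder i div) (max low (proj₁ isOrder))))
    ... | no ¬order           = ⊥-elim (¬order (low , isOrder))

  -- The square of `max1 k` is the growth function at q^k, including the exceptional value 1 at k =
  -- 0.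
  max1 : ℕ → ℕ
  max1 zero    = 1
  max1 (suc k) = suc k

  q^-injective : ∀ {k l} → q^ (+ k) ≡ q^ (+ l) → k ≡ l
  q^-injective {k} {l} eq = ^-inj (ι-injective eq)
    where
    ^-inj : q ℕ.^ k ≡ q ℕ.^ l → k ≡ l
    ^-inj eq with ℕ.<-cmp k l
    ... | tri< k<l _ _ = ⊥-elim (ℕ.<-irrefl eq (ℕ.^-monoʳ-< q 2≤q k<l))
    ... | tri≈ _ k≡l _ = k≡l
    ... | tri> _ _ l<k = ⊥-elim (ℕ.<-irrefl (sym eq) (ℕ.^-monoʳ-< q 2≤q l<k))

  -- `growth` takes whatever exponent excluded middle supplies; as q ≥ 2, an exponent is determined
  -- by its power.
  log²-q^ : ∀ k → log² (q^ (+ k)) ≡ ι (max1 k ℕ.* max1 k)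
  log²-q^ zero with em {∃[ l ] (q^ (+ 0) ≡ q^ (+ l))}
  ... | no ¬∃ = ⊥-elim (¬∃ (0 , refl))
  ... | yes (l , eq) with refl ← q^-injective {0} {l} eq = refl
  log²-q^ (suc k) with em {∃[ l ] (q^ (+ suc k) ≡ q^ (+ l))}
  ... | no ¬∃ = ⊥-elim (¬∃ (suc k , refl))
  ... | yes (l , eq) with refl ← q^-injective {suc k} {l} eq = refl

  open Recurrence F.commutativeRing using (Recurrent)
  open import Algebra.Properties.Ring F.ring using (-‿distribˡ-*; -‿distribʳ-*)
  open import Algebra.Properties.Semiring.Sum F.semiring using (sum; sum-cong-≋; sum-replicate-zero; *-distribˡ-sum)
  private module ≈-Reasoning where
    open import Relation.Binary.Reasoning.Setoid F.setoid public

  sum-split : ∀ m {n} (f : ℕ → F.Carrier) →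
    sum {m ℕ.+ n} (f ∘ toℕ) F.≈ sum {m} (f ∘ toℕ) F.+ sum {n} (λ i → f (m ℕ.+ toℕ i))
  sum-split zero    {n} f = F.sym (F.+-identityˡ _)
  sum-split (suc m) {n} f = F.trans (F.+-congˡ (sum-split m {n} (λ i → f (suc i)))) (F.sym (F.+-assoc _ _ _))

  sum≈0 : ∀ {n} {f : Fin n → F.Carrier} → (∀ i → f i F.≈ F.0#) → sum {n} f F.≈ F.0#
  sum≈0 {n} f≈0 = F.trans (sum-cong-≋ {n} f≈0) (sum-replicate-zero n)

  module _ {N : 𝔽[t]} (E : Extent N) where
    open Extent E

    -- The coefficient of t^-(r+1) in Θ · N for Θ = `series a`.
    row : (ℕ → F.Carrier) → ℕ → F.Carrier
    row a r = sum {length N} (λ i → coeffₚ N (toℕ i) F.* a (r ℕ.+ toℕ i))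

    top⁻¹ : F.Carrier
    top⁻¹ = proj₁ (F.invertible _ top≉0)

    recurrence : Fin span → F.Carrier
    recurrence i = (F.- top⁻¹) F.* coeffₚ N (low ℕ.+ toℕ i)

    -- Only the coefficients of N from `low` to `low + span` contribute. The factor t^low of N thus
    -- merely shifts the sequence, and the recurrence has order `span` instead of the degree of N.
    row-trim : ∀ a r → row a r F.≈ sum {span} (λ i → coeffₚ N (low ℕ.+ toℕ i) F.* a (low ℕ.+ (r ℕ.+ toℕ i)))
                                  F.+ coeffₚ N (low ℕ.+ span) F.* a (low ℕ.+ (r ℕ.+ span))
    row-trim a r = begin
      sum {length N} (λ i → f (toℕ i))
        ≡⟨ cong (λ n → sum {n} (λ i → f (toℕ i))) len ⟩
      sum {low ℕ.+ (span ℕ.+ suc e)} (λ i → f (toℕ i))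
        ≈⟨ sum-split low {span ℕ.+ suc e} f ⟩
      sum {low} (λ i → f (toℕ i)) F.+ sum {span ℕ.+ suc e} (λ i → f (low ℕ.+ toℕ i))
        ≈⟨ F.+-cong (sum≈0 {low} (λ i → zero* (below≈0 (toℕ i) (Fin.toℕ<n i)))) (sum-split span {suc e} (λ i → f (low ℕ.+ i))) ⟩
      F.0# F.+ (sum {span} (λ i → f (low ℕ.+ toℕ i)) F.+ (f (low ℕ.+ (span ℕ.+ 0)) F.+ sum {e} (λ i → f (low ℕ.+ (span ℕ.+ suc (toℕ i))))))
        ≈⟨ F.trans (F.+-identityˡ _) (F.+-congˡ (F.trans (F.+-congˡ (sum≈0 {e} (λ i → zero* (above≈0 _ (beyond (toℕ i)))))) (F.+-identityʳ _))) ⟩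
      sum {span} (λ i → f (low ℕ.+ toℕ i)) F.+ f (low ℕ.+ (span ℕ.+ 0))
        ≈⟨ F.+-cong (sum-cong-≋ {span} (λ i → F.reflexive (cong (λ m → coeffₚ N (low ℕ.+ toℕ i) F.* a m) (shuffle r low (toℕ i)))))
             (F.reflexive (trans (cong (λ m → f (low ℕ.+ m)) (ℕ.+-identityʳ span)) (cong (λ m → coeffₚ N (low ℕ.+ span) F.* a m) (shuffle r low span)))) ⟩
      sum {span} (λ i → coeffₚ N (low ℕ.+ toℕ i) F.* a (low ℕ.+ (r ℕ.+ toℕ i)))
        F.+ coeffₚ N (low ℕ.+ span) F.* a (low ℕ.+ (r ℕ.+ span)) ∎
      where
      open ≈-Reasoning
      f : ℕ → F.Carrier
      f i = coeffₚ N i F.* a (r ℕ.+ i)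
      -- The number of trailing zeros listed after the top coefficient.
      e = length N ℕ.∸ suc (low ℕ.+ span)
      len : length N ≡ low ℕ.+ (span ℕ.+ suc e)
      len = trans (sym (ℕ.m+[n∸m]≡n top<len)) (trans (sym (ℕ.+-suc (low ℕ.+ span) e)) (ℕ.+-assoc low span (suc e)))
      beyond : ∀ i → low ℕ.+ span ℕ.< low ℕ.+ (span ℕ.+ suc i)
      beyond i = ℕ.+-monoʳ-< low (ℕ.m<m+n span (s≤s z≤n))
      zero* : ∀ {x y} → x F.≈ F.0# → x F.* y F.≈ F.0#
      zero* x≈0 = F.trans (F.*-congʳ x≈0) (F.zeroˡ _)
      shuffle : ∀ r j i → r ℕ.+ (j ℕ.+ i) ≡ j ℕ.+ (r ℕ.+ i)
      shuffle = solve-∀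

    row≈0⇒recurrent : ∀ a n → (∀ r → r ℕ.< n → row a r F.≈ F.0#) → Recurrent recurrence a low n
    row≈0⇒recurrent a n row≈0 r r<n = begin
      A                            ≈⟨ F.*-identityˡ A ⟨
      F.1# F.* A                   ≈⟨ F.*-congʳ (F.trans (F.*-comm _ _) (proj₂ (F.invertible _ top≉0))) ⟨
      top⁻¹ F.* T F.* A            ≈⟨ F.*-assoc _ _ _ ⟩
      top⁻¹ F.* (T F.* A)          ≈⟨ F.*-congˡ TA≈-S ⟩
      top⁻¹ F.* (F.- S)            ≈⟨ F.trans (F.sym (-‿distribʳ-* _ _)) (-‿distribˡ-* _ _) ⟩
      (F.- top⁻¹) F.* S            ≈⟨ *-distribˡ-sum {span} (F.- top⁻¹) _ ⟩
      sum {span} (λ i → (F.- top⁻¹) F.* (coeffₚ N (low ℕ.+ toℕ i) F.* a (low ℕ.+ (r ℕ.+ toℕ i))))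
        ≈⟨ sum-cong-≋ {span} (λ i → F.sym (F.*-assoc _ _ _)) ⟩
      sum {span} (λ i → recurrence i F.* a (low ℕ.+ (r ℕ.+ toℕ i))) ∎
      where
      open ≈-Reasoning
      A = a (low ℕ.+ (r ℕ.+ span))
      T = coeffₚ N (low ℕ.+ span)
      S = sum {span} (λ i → coeffₚ N (low ℕ.+ toℕ i) F.* a (low ℕ.+ (r ℕ.+ toℕ i)))
      TA≈-S : T F.* A F.≈ F.- S
      TA≈-S = inverseʳ-unique S (T F.* A) (F.trans (F.sym (row-trim a r)) (row≈0 r r<n))
        where open import Algebra.Properties.Group F.+-group using (inverseʳ-unique)

    -- If the first n rows all vanished, solving each for its top term would make the sequence
    -- recurrent. So one of them is nonzero, and it bounds the absolute value from below.
    ∣⟨·⟩∣-lower : ∀ a n → ¬ Recurrent recurrence a low n → ρ q ^ n ℚ.≤ ∣ ⟨ series a · N ⟩ ∣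
    ∣⟨·⟩∣-lower a n ¬rec with em {∃[ r ] (r ℕ.< n × ¬ row a r F.≈ F.0#)}
    ... | yes (r , r<n , row≉0) = ℚ.≤-trans (ρ^-anti r<n)
      (ℚ.≤-trans (ℚ.≤-reflexive (sym (q^-neg (suc r)))) (∣∣-lower ⟨ series a · N ⟩ (+ suc r) row≉0))
    ... | no ¬∃ = ⊥-elim (¬rec (row≈0⇒recurrent a n row≈0))
      where
      row≈0 : ∀ r → r ℕ.< n → row a r F.≈ F.0#
      row≈0 r r<n with em {row a r F.≈ F.0#}
      ... | yes ≈0 = ≈0
      ... | no  ≉0 = ⊥-elim (¬∃ (r , r<n , ≉0))

  module _ (D : ℕ) .{{D≢0 : ℕ.NonZero D}} (ℓ : ℕ → ℕ) (ℓ-small : ∀ n → q ℕ.^ ℓ n ℕ.≤ (D ℕ.* (2 ℕ.+ n)) ℕ.^ 2) where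

    private
      -- The 4 comes from 2 + j + 2d ≤ 4 `max1 (j + d)`, and 1/K will be the positive lower bound.
      K = (4 ℕ.* D) ℕ.* (4 ℕ.* D)
      instance
        K≢0 : ℕ.NonZero K
        K≢0 = ℕ.m*n≢0 (4 ℕ.* D) (4 ℕ.* D) {{ℕ.m*n≢0 4 D}} {{ℕ.m*n≢0 4 D}}

    ℓ-≤ : ∀ j d → q ℕ.^ ℓ (j ℕ.+ (d ℕ.+ d)) ℕ.≤ K ℕ.* (max1 (j ℕ.+ d) ℕ.* max1 (j ℕ.+ d))
    ℓ-≤ j d = begin
      q ℕ.^ ℓ (j ℕ.+ (d ℕ.+ d))                   ≤⟨ ℓ-small (j ℕ.+ (d ℕ.+ d)) ⟩
      (D ℕ.* (2 ℕ.+ (j ℕ.+ (d ℕ.+ d)))) ℕ.^ 2     ≤⟨ ℕ.^-monoˡ-≤ 2 (ℕ.*-monoʳ-≤ D bound4) ⟩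
      (D ℕ.* (4 ℕ.* m)) ℕ.^ 2                     ≡⟨ lem D m ⟩
      K ℕ.* (m ℕ.* m)                             ∎
      where
      open ℕ.≤-Reasoning
      m = max1 (j ℕ.+ d)
      lem : ∀ D m → (D ℕ.* (4 ℕ.* m)) ℕ.* ((D ℕ.* (4 ℕ.* m)) ℕ.* 1) ≡ (4 ℕ.* D) ℕ.* (4 ℕ.* D) ℕ.* (m ℕ.* m)
      lem = solve-∀
      max1-lem : ∀ k → 2 ℕ.+ (k ℕ.+ k) ℕ.≤ 4 ℕ.* max1 k
      max1-lem zero    = s≤s (s≤s z≤n)
      max1-lem (suc k) = ℕ.≤-trans (ℕ.m≤m+n (2 ℕ.+ (suc k ℕ.+ suc k)) (k ℕ.+ k)) (ℕ.≤-reflexive (lem′ k))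
        where
        lem′ : ∀ k → 2 ℕ.+ (suc k ℕ.+ suc k) ℕ.+ (k ℕ.+ k) ≡ 4 ℕ.* suc k
        lem′ = solve-∀
      bound4 : 2 ℕ.+ (j ℕ.+ (d ℕ.+ d)) ℕ.≤ 4 ℕ.* m
      bound4 = ℕ.≤-trans (ℕ.+-monoʳ-≤ 2 (ℕ.≤-trans (ℕ.≤-reflexive (sym (ℕ.+-assoc j d d))) (ℕ.+-monoʳ-≤ (j ℕ.+ d) (ℕ.m≤n+m d j)))) (max1-lem (j ℕ.+ d))

    -- For N = t^j Q with deg Q = d and Q(0) ≠ 0, the factors q^(j+d), q^-(d+l) and q^-j multiply to
    -- q^-l, where q^l is at most K times the value of the growth function.
    ¬recurrent⇒∈M : ∀ a → (∀ j {d} (Q : Fin d → F.Carrier) → ¬ Recurrent Q a j (d ℕ.+ ℓ (j ℕ.+ (d ℕ.+ d)))) → M log² (series a)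
    ¬recurrent⇒∈M a ¬rec = series∈𝕀 a , + 1 / K , />0 1 K , bound′
      where
      bound′ : ∀ N → ¬ (N ≈ₚ []) →
        + 1 / K ℚ.≤ log² ∣ toSeries N ∣ ℚ.* ∣ toSeries N ∣ ℚ.* ∣ ⟨ series a · N ⟩ ∣ ℚ.* ∣ N ∣ₜ
      bound′ N N≉0 = begin
        + 1 / K                                            ≤⟨ chain (+ 1 / K) (ℚ.<⇒≤ (/>0 1 K)) (/-*-ι 1 K) ⟩
        ι g ℚ.* ρ q ^ l                                    ≡⟨ cancel ⟩
        ι g ℚ.* ι q ^ (j ℕ.+ d) ℚ.* ρ q ^ (d ℕ.+ l) ℚ.* ρ q ^ j
          ≤⟨ *-monoʳ (^≥0 j 0≤ρ) (*-monoˡ (*≥0 (ι≥0 g) (^≥0 (j ℕ.+ d) (ι≥0 q))) (∣⟨·⟩∣-lower E a (d ℕ.+ l) (¬rec j (recurrence E)))) ⟩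
        ι g ℚ.* ι q ^ (j ℕ.+ d) ℚ.* ∣ ⟨ series a · N ⟩ ∣ ℚ.* ρ q ^ j
          ≡⟨ cong₂ (λ x y → x ℚ.* ∣ ⟨ series a · N ⟩ ∣ ℚ.* y) (cong₂ ℚ._*_ (trans (cong log² (∣toSeries∣ E)) (log²-q^ (j ℕ.+ d))) (trans (∣toSeries∣ E) (ι-^ q (j ℕ.+ d)))) (∣∣ₜ≡ E) ⟨
        log² ∣ toSeries N ∣ ℚ.* ∣ toSeries N ∣ ℚ.* ∣ ⟨ series a · N ⟩ ∣ ℚ.* ∣ N ∣ₜ ∎
        where
        open ℚ.≤-Reasoning
        open +-*-Solver
        E = extent N N≉0
        j = Extent.low E
        d = Extent.span E
        l = ℓ (j ℕ.+ (d ℕ.+ d))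
        g = max1 (j ℕ.+ d) ℕ.* max1 (j ℕ.+ d)

        chain : ∀ c → 0ℚ ℚ.≤ c → c ℚ.* ι K ≡ 1ℚ → c ℚ.≤ ι g ℚ.* ρ q ^ l
        chain c 0≤c cK≡1 = begin
          c                                      ≡⟨ ℚ.*-identityʳ c ⟨
          c ℚ.* 1ℚ                               ≡⟨ cong (c ℚ.*_) (^-inverse (ρ q) (ι q) l (ρ*ι≡1 q)) ⟨
          c ℚ.* (ρ q ^ l ℚ.* ι q ^ l)            ≡⟨ cong (λ x → c ℚ.* (ρ q ^ l ℚ.* x)) (ι-^ q l) ⟨
          c ℚ.* (ρ q ^ l ℚ.* ι (q ℕ.^ l))        ≤⟨ *-monoˡ 0≤c (*-monoˡ (^≥0 l 0≤ρ) (ι-mono (ℓ-≤ j d))) ⟩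
          c ℚ.* (ρ q ^ l ℚ.* ι (K ℕ.* g))        ≡⟨ cong (λ x → c ℚ.* (ρ q ^ l ℚ.* x)) (ι-* K g) ⟩
          c ℚ.* (ρ q ^ l ℚ.* (ι K ℚ.* ι g))      ≡⟨ solve 4 (λ c r k g → c :* (r :* (k :* g)) := c :* k :* (g :* r)) refl c (ρ q ^ l) (ι K) (ι g) ⟩
          c ℚ.* ι K ℚ.* (ι g ℚ.* ρ q ^ l)        ≡⟨ cong (ℚ._* (ι g ℚ.* ρ q ^ l)) cK≡1 ⟩
          1ℚ ℚ.* (ι g ℚ.* ρ q ^ l)               ≡⟨ ℚ.*-identityˡ _ ⟩
          ι g ℚ.* ρ q ^ l                        ∎

        cancel : ι g ℚ.* ρ q ^ l ≡ ι g ℚ.* ι q ^ (j ℕ.+ d) ℚ.* ρ q ^ (d ℕ.+ l) ℚ.* ρ q ^ j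
        cancel = sym (begin-equality
          ι g ℚ.* ι q ^ (j ℕ.+ d) ℚ.* ρ q ^ (d ℕ.+ l) ℚ.* ρ q ^ j
            ≡⟨ cong₂ (λ x y → ι g ℚ.* x ℚ.* y ℚ.* ρ q ^ j) (^-homo-* (ι q) j d) (^-homo-* (ρ q) d l) ⟩
          ι g ℚ.* (ι q ^ j ℚ.* ι q ^ d) ℚ.* (ρ q ^ d ℚ.* ρ q ^ l) ℚ.* ρ q ^ j
            ≡⟨ solve 6 (λ g ij id rd rl rj → g :* (ij :* id) :* (rd :* rl) :* rj := (rj :* ij) :* ((rd :* id) :* (g :* rl))) refl
                 (ι g) (ι q ^ j) (ι q ^ d) (ρ q ^ d) (ρ q ^ l) (ρ q ^ j) ⟩
          (ρ q ^ j ℚ.* ι q ^ j) ℚ.* ((ρ q ^ d ℚ.* ι q ^ d) ℚ.* (ι g ℚ.* ρ q ^ l))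
            ≡⟨ cong₂ (λ x y → x ℚ.* (y ℚ.* (ι g ℚ.* ρ q ^ l))) (^-inverse (ρ q) (ι q) j (ρ*ι≡1 q)) (^-inverse (ρ q) (ι q) d (ρ*ι≡1 q)) ⟩
          1ℚ ℚ.* (1ℚ ℚ.* (ι g ℚ.* ρ q ^ l))
            ≡⟨ trans (ℚ.*-identityˡ _) (ℚ.*-identityˡ _) ⟩
          ι g ℚ.* ρ q ^ l ∎)

-- Rational exponents near 1 and approximation by powers of 1/q

<1⇒<d/[1+d] : ∀ r → r ℚ.< 1ℚ → ∃[ k ] (r ℚ.< + suc k / suc (suc k))
-- Here n ≤ k, so r ≤ k/(k+1) < (k+1)/(k+2). Exponents of the form p/(p+1) suit the estimate of
-- γ^(p+1) by q^-p.
<1⇒<d/[1+d] r@(ℚ.mkℚ n k _) r<1 = k , subst (ℚ._< + suc k / suc (suc k)) (ℚ.↥p/↧p≡p r)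
  (/-mono-< n (+ suc k) (suc k) (suc (suc k)) (ℤ.≤-<-trans
    (ℤ.*-monoʳ-≤-nonNeg (+ suc (suc k)) n≤k) (subst₂ ℤ._<_ (ℤ.pos-* k (suc (suc k))) (ℤ.pos-* (suc k) (suc k)) (ℤ.+<+ (ℕ.≤-reflexive (lem k))))))
  where
  n≤k : n ℤ.≤ + k
  n≤k = ℤ.i<j⇒i≤pred[j] (subst₂ ℤ._<_ (ℤ.*-identityʳ n) (ℤ.*-identityˡ (+ suc k)) (ℚ.drop-*<* r<1))
  lem : ∀ k → suc (k ℕ.* suc (suc k)) ≡ suc k ℕ.* suc k
  lem = solve-∀

>1⇒>[1+b]/b : ∀ r → 1ℚ ℚ.< r → ∃[ k ] (+ suc (suc k) / suc k ℚ.< r)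
-- Here n ≥ k + 2, so r ≥ (k+2)/(k+1) > (k+3)/(k+2), which is the fraction belonging to the witness
-- k + 1.
>1⇒>[1+b]/b r@(ℚ.mkℚ n k _) 1<r = suc k , subst (+ suc (suc (suc k)) / suc (suc k) ℚ.<_) (ℚ.↥p/↧p≡p r)
  (/-mono-< (+ suc (suc (suc k))) n (suc (suc k)) (suc k) (ℤ.<-≤-trans
    (subst₂ ℤ._<_ (ℤ.pos-* (suc (suc (suc k))) (suc k)) (ℤ.pos-* (suc (suc k)) (suc (suc k))) (ℤ.+<+ (ℕ.≤-reflexive (lem k))))
    (ℤ.*-monoʳ-≤-nonNeg (+ suc (suc k)) k<n)))
  where
  k<n : + suc (suc k) ℤ.≤ n
  k<n = ℤ.i<j⇒suc[i]≤j (subst₂ ℤ._<_ (ℤ.*-identityˡ (+ suc k)) (ℤ.*-identityʳ n) (ℚ.drop-*<* 1<r))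
  lem : ∀ k → suc (suc (suc (suc k)) ℕ.* suc k) ≡ suc (suc k) ℕ.* suc (suc k)
  lem = solve-∀

below-above-< : ∀ s {r r′} → below s r → above s r′ → r ℚ.< r′
below-above-< s {r} {r′} s>r s<r′ with ℚ.<-cmp r r′
... | tri< r<r′ _ _   = r<r′
... | tri≈ _ refl _   = ⊥-elim (disjoint s r s>r s<r′)
... | tri> _ _ r′<r   = ⊥-elim (disjoint s r′ (Equivalence.from (below-rounded s r′) (r , r′<r , s>r)) s<r′)

n<q^n : ∀ q → 2 ℕ.≤ q → ∀ n → n ℕ.< q ℕ.^ n
n<q^n q 2≤q zero    = s≤s z≤n
n<q^n q 2≤q (suc n) = begin
  suc (suc n)        ≤⟨ ℕ.m≤n+m (suc (suc n)) n ⟩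
  n ℕ.+ suc (suc n)  ≡⟨ ℕ.+-suc n (suc n) ⟩
  suc n ℕ.+ suc n    ≡⟨ cong (suc n ℕ.+_) (ℕ.+-identityʳ (suc n)) ⟨
  2 ℕ.* suc n        ≤⟨ ℕ.*-mono-≤ 2≤q (n<q^n q 2≤q n) ⟩
  q ℕ.* q ℕ.^ n      ∎
  where open ℕ.≤-Reasoning

∃-ρ^≤ : ∀ q .{{_ : ℕ.NonZero q}} → 2 ℕ.≤ q → ∀ d → 0ℚ ℚ.< d → ∃[ m ] ρ q ^ m ℚ.≤ d
∃-ρ^≤ q 2≤q d 0<d = n , (begin
  ρ q ^ n                            ≡⟨ ℚ.*-identityʳ _ ⟨
  ρ q ^ n ℚ.* 1ℚ                     ≤⟨ *-monoˡ (^≥0 n 0≤ρ) 1≤ ⟩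
  ρ q ^ n ℚ.* (d ℚ.* ι q ^ n)        ≡⟨ solve 3 (λ r d i → r :* (d :* i) := (r :* i) :* d) refl (ρ q ^ n) d (ι q ^ n) ⟩
  ρ q ^ n ℚ.* ι q ^ n ℚ.* d          ≡⟨ cong (ℚ._* d) (^-inverse (ρ q) (ι q) n (ρ*ι≡1 q)) ⟩
  1ℚ ℚ.* d                           ≡⟨ ℚ.*-identityˡ d ⟩
  d                                  ∎)
  where
  open ℚ.≤-Reasoning
  open +-*-Solver
  instance
    d≢0 : ℚ.NonZero d
    d≢0 = ℚ.pos⇒nonZero d {{ℚ.positive 0<d}}
  0≤ρ = ℚ.<⇒≤ (ρ>0 q)
  n = proj₁ (∃-ι> (ℚ.1/ d))
  1≤ : 1ℚ ℚ.≤ d ℚ.* ι q ^ n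
  1≤ = begin
    1ℚ                ≡⟨ ℚ.*-inverseʳ d ⟨
    d ℚ.* ℚ.1/ d      ≤⟨ *-monoˡ (ℚ.<⇒≤ 0<d) (ℚ.<⇒≤ (proj₂ (∃-ι> (ℚ.1/ d)))) ⟩
    d ℚ.* ι n         ≤⟨ *-monoˡ (ℚ.<⇒≤ 0<d) (ι-mono (ℕ.<⇒≤ (n<q^n q 2≤q n))) ⟩
    d ℚ.* ι (q ℕ.^ n) ≡⟨ cong (d ℚ.*_) (ι-^ q n) ⟩
    d ℚ.* ι q ^ n     ∎

∃-ρ^-approx : ∀ q .{{_ : ℕ.NonZero q}} → 2 ℕ.≤ q → ∀ d → 0ℚ ℚ.< d → d ℚ.< 1ℚ → ∃[ m ] (ρ q ^ suc m ℚ.≤ d × d ℚ.< ρ q ^ m)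
∃-ρ^-approx q 2≤q d 0<d d<1 = let N , ρᴺ≤d = ∃-ρ^≤ q 2≤q d 0<d in search N ρᴺ≤d
  where
  search : ∀ N → ρ q ^ N ℚ.≤ d → ∃[ m ] (ρ q ^ suc m ℚ.≤ d × d ℚ.< ρ q ^ m)
  search zero    1≤d  = ⊥-elim (ℚ.<-irrefl refl (ℚ.<-≤-trans d<1 1≤d))
  search (suc N) ρ≤d with ρ q ^ N ℚ.≤? d
  ... | yes p = search N p
  ... | no ¬p = N , ρ≤d , ℚ.≰⇒> ¬p

0^n≡0 : ∀ n .{{_ : ℕ.NonZero n}} → 0ℚ ^ n ≡ 0ℚ
0^n≡0 (suc n) = ℚ.*-zeroˡ (0ℚ ^ n)

sum-threshold : ∀ {N} K {w} (y : Fin N → ℚ) → 0ℚ ℚ.≤ w → (∀ i → toℕ i ℕ.< K → y i ℚ.≤ w) →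
  (∀ i → K ℕ.≤ toℕ i → y i ℚ.≤ 0ℚ) → ℚ∑.sum y ℚ.≤ ι K ℚ.* w
sum-threshold {zero}  K y 0≤w _ _ = *≥0 (ι≥0 K) 0≤w
sum-threshold {suc N} zero {w} y 0≤w y≤w y≤0 = ℚ.≤-trans
  (ℚ.+-mono-≤ (y≤0 zero z≤n) (sum-threshold zero {w} (y ∘ suc) 0≤w (λ _ ()) (λ i _ → y≤0 (suc i) z≤n)))
  (ℚ.≤-reflexive (ℚ.+-identityˡ _))
sum-threshold {suc N} (suc K) {w} y 0≤w y≤w y≤0 = ℚ.≤-trans
  (ℚ.+-mono-≤ (y≤w zero (s≤s z≤n)) (sum-threshold K {w} (y ∘ suc) 0≤w (λ i i<K → y≤w (suc i) (s≤s i<K)) (λ i K≤i → y≤0 (suc i) (s≤s K≤i))))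
  (ℚ.≤-reflexive (sym (ι-suc-* K w)))

-- Upper bound

module Upper {q : ℕ} (F : FiniteField q) (em : ExcludedMiddle 0ℓ) where
  open Polynomials F em
  open Laurent F em
  private module F = FiniteField F

  𝕀⇒vanish : ∀ Θ → 𝕀 Θ → ∀ z → z ℤ.≤ + 0 → coeff Θ z F.≈ F.0#
  𝕀⇒vanish Θ ∣Θ∣<1 z z≤0 with em {coeff Θ z F.≈ F.0#}
  ... | yes Θ≈0 = Θ≈0
  ... | no  Θ≉0 = ⊥-elim (ℚ.<-irrefl refl (ℚ.<-≤-trans ∣Θ∣<1
    (ℚ.≤-trans (q^-mono (ℤ.neg-mono-≤ z≤0)) (∣∣-lower Θ z Θ≉0))))

  pad : ∀ {n} → (Fin n → F.Carrier) → F.Carrier → ℕ → F.Carrier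
  pad {n} w e k with k ℕ.<? n
  ... | yes k<n = w (fromℕ< k<n)
  ... | no _    = e

  pad-< : ∀ {n} (w : Fin n → F.Carrier) e {k} (k<n : k ℕ.< n) → pad w e k ≡ w (fromℕ< k<n)
  pad-< {n} w e {k} k<n with k ℕ.<? n
  ... | yes _  = refl
  ... | no k≮n = ⊥-elim (k≮n k<n)

  pad-n : ∀ {n} (w : Fin n → F.Carrier) e → pad w e n ≡ e
  pad-n {n} w e with n ℕ.<? n
  ... | yes n<n = ⊥-elim (ℕ.<-irrefl refl n<n)
  ... | no _    = refl

  module Cylinders (n : ℕ) where

    Prefix : (Fin n → F.Carrier) → 𝕃 → Set
    Prefix w Θ = ∀ z → z ℤ.≤ + n → coeff Θ z F.≈ coeff (series (pad w F.0#)) z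

    ∣⊖∣≤ : ∀ {w Θ Φ} → Prefix w Θ → Prefix w Φ → ∣ Θ ⊖ Φ ∣ ℚ.≤ ρ q ^ suc n
    ∣⊖∣≤ {w} {Θ} {Φ} Θ∈ Φ∈ = ℚ.≤-trans (∣∣-upper (Θ ⊖ Φ) (ℤ.- + suc n) λ z z<n →
        x≈y⇒x-y≈0 (F.trans (Θ∈ z (ℤ.i<j⇒i≤pred[j] z<n)) (F.sym (Φ∈ z (ℤ.i<j⇒i≤pred[j] z<n)))))
      (ℚ.≤-reflexive (q^-neg (suc n)))
      where open import Algebra.Properties.Group F.+-group using () renaming (x≈y⇒x∙y⁻¹≈ε to x≈y⇒x-y≈0)

    pad∈Prefix : ∀ w e → Prefix w (series (pad w e))
    pad∈Prefix w e -[1+ _ ]  _ = F.refl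
    pad∈Prefix w e (+ zero)  _ = F.refl
    pad∈Prefix w e (+ suc k) (ℤ.+≤+ k<n) = F.reflexive (trans (pad-< w e k<n) (sym (pad-< w F.0# k<n)))

    -- The distance is attained: w continued by ones and w continued by zeros first differ at
    -- t^-(n+1).
    prefix-diameter : ∀ w → IsDiameter (Prefix w) (ρ q ^ suc n)
    prefix-diameter w = (^≥0 (suc n) 0≤ρ , λ Θ Φ Θ∈ Φ∈ → ∣⊖∣≤ {w} {Θ} {Φ} Θ∈ Φ∈) , λ e (_ , bounded) → ℚ.≤-trans
      (ℚ.≤-trans (ℚ.≤-reflexive (sym (q^-neg (suc n))))
        (∣∣-lower (series (pad w F.1#) ⊖ series (pad w F.0#)) (+ suc n) λ 1-0≈0 →
          F.0≉1 (F.sym (F.trans (F.reflexive (sym (pad-n w F.1#)))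
            (F.trans (x-y≈0⇒x≈y _ _ 1-0≈0) (F.reflexive (pad-n w F.0#)))))))
      (bounded (series (pad w F.1#)) (series (pad w F.0#)) (pad∈Prefix w F.1#) (pad∈Prefix w F.0#))
      where open import Algebra.Properties.Group F.+-group using () renaming (x∙y⁻¹≈ε⇒x≈y to x-y≈0⇒x≈y)

    word : ∀ {i} → .(i ℕ.< q ℕ.^ n) → Fin n → F.Carrier
    word i< = from ∘ finToFun (fromℕ< i<)

    -- Covers are sequences indexed by ℕ, so empty sets follow the q^n cylinders.
    U : ℕ → 𝕃 → Set
    U i Θ = Σ (i ℕ.< q ℕ.^ n) λ i< → Prefix (word i<) Θ

    diam : ℕ → ℚ
    diam i with i ℕ.<? q ℕ.^ n
    ... | yes _ = ρ q ^ suc n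
    ... | no _  = 0ℚ

    U-diameter : ∀ i → IsDiameter (U i) (diam i)
    U-diameter i with i ℕ.<? q ℕ.^ n
    ... | no  i≮ = (ℚ.≤-refl , λ _ _ (i< , _) → ⊥-elim (i≮ i<)) , λ _ → proj₁
    ... | yes i< = let (0≤ , upper) , least = prefix-diameter (word i<) in
      (0≤ , λ Θ Φ (_ , Θ∈) (_ , Φ∈) → upper Θ Φ Θ∈ Φ∈) ,
      λ e (0≤e , bounded) → least e (0≤e , λ Θ Φ Θ∈ Φ∈ → bounded Θ Φ (i< , Θ∈) (i< , Φ∈))

    diam-< : ∀ i → i ℕ.< q ℕ.^ n → diam i ≡ ρ q ^ suc n
    diam-< i i< with i ℕ.<? q ℕ.^ n
    ... | yes _ = refl
    ... | no i≮ = ⊥-elim (i≮ i<)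

    diam-≥ : ∀ i → q ℕ.^ n ℕ.≤ i → diam i ≡ 0ℚ
    diam-≥ i ≤i with i ℕ.<? q ℕ.^ n
    ... | yes i< = ⊥-elim (ℕ.<⇒≱ i< ≤i)
    ... | no _   = refl

    diam-≤ : ∀ i → diam i ℚ.≤ ρ q ^ suc n
    diam-≤ i with i ℕ.<? q ℕ.^ n
    ... | yes _ = ℚ.≤-refl
    ... | no _  = ^≥0 (suc n) 0≤ρ

    U-covers : ∀ Θ → 𝕀 Θ → ∃[ i ] U i Θ
    U-covers Θ Θ∈𝕀 = toℕ code , Fin.toℕ<n code , prefix
      where
      to = Inverse.to F.enumeration
      digits : Fin n → Fin q
      digits k = to (coeff Θ (+ suc (toℕ k)))
      code = funToFin digits
      word≡ : ∀ k → word (Fin.toℕ<n code) k ≡ from (digits k)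
      word≡ k = cong from (trans (cong (λ c → finToFun c k) (Fin.fromℕ<-toℕ code (Fin.toℕ<n code))) (Fin.finToFun-funToFin digits k))
      prefix : Prefix (word (Fin.toℕ<n code)) Θ
      prefix -[1+ m ]  _ = 𝕀⇒vanish Θ Θ∈𝕀 -[1+ m ] ℤ.-≤+
      prefix (+ zero)  _ = 𝕀⇒vanish Θ Θ∈𝕀 (+ 0) ℤ.≤-refl
      prefix (+ suc k) (ℤ.+≤+ k<n) = F.sym (F.trans
        (F.reflexive (trans (pad-< (word (Fin.toℕ<n code)) F.0# k<n) (trans (word≡ (fromℕ< k<n))
          (cong (λ m → from (to (coeff Θ (+ suc m)))) (Fin.toℕ-fromℕ< k<n)))))
        (Inverse.strictlyInverseʳ F.enumeration _))

  -- The q^n cylinders have diameter q^-(n+1), so their cost at exponent s is of order q^(n(1-s)),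
  -- which tends to 0 for s > 1.
  𝕀-null : ∀ E → (∀ Θ → E Θ → 𝕀 Θ) → ∀ s → 1ℚ ℚ.< s → Hausdorff[ fromℚ s ] E ≤ 0ℚ
  𝕀-null E E⊆𝕀 s 1<s δ 0<δ η 0<η = U , diam , record
      { covers   = λ Θ Θ∈E → U-covers Θ (E⊆𝕀 Θ Θ∈E)
      ; diameter = U-diameter
      ; fine     = λ i → ℚ.≤-trans (diam-≤ i) ρⁿ≤δ }
    , λ N y y≤ → ℚ.≤-trans
        (sum-threshold {N} (q ℕ.^ n) {w} y (^≥0 (m ℕ.* suc b) 0≤ρ)
          (λ i i< → y≤w (y i) (subst (y i ≤_^ℝ fromℚ s) (diam-< (toℕ i) i<) (proj₂ (y≤ i))))
          (λ i ≤i → y≤0 (y i) (subst (y i ≤_^ℝ fromℚ s) (diam-≥ (toℕ i) ≤i) (proj₂ (y≤ i)))))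
        qⁿw≤η
    where
    k = proj₁ (>1⇒>[1+b]/b s 1<s)
    b = suc k
    b+1/b<s : + suc b / b ℚ.< s
    b+1/b<s = proj₂ (>1⇒>[1+b]/b s 1<s)
    m₁ = ∃-ρ^≤ q 2≤q δ 0<δ
    m₂ = ∃-ρ^≤ q 2≤q η 0<η
    m′ = proj₁ m₁ ℕ.⊔ proj₁ m₂
    m = suc m′
    -- Chosen so that n + 1 = m b: the exponent (b+1)/b < s then turns the diameter into w =
    -- q^-(m(b+1)) without roots, and q^n w = q^-(m+1). The maximum m′ makes the diameter at most δ
    -- and this total at most η.
    n = m′ ℕ.+ k ℕ.* m
    open Cylinders n
    w = ρ q ^ (m ℕ.* suc b)
    open ℚ.≤-Reasoning

    ρⁿ≤δ : ρ q ^ suc n ℚ.≤ δ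
    ρⁿ≤δ = ℚ.≤-trans (ρ^-anti {proj₁ m₁} {suc n} (ℕ.≤-trans (ℕ.m≤m⊔n _ _) (ℕ.≤-trans (ℕ.n≤1+n m′) (ℕ.m≤m+n m (k ℕ.* m))))) (proj₂ m₁)

    ρ≤1ℚ : ρ q ^ suc n ℚ.≤ 1ℚ
    ρ≤1ℚ = ρ^-anti {0} {suc n} z≤n

    y≤w : ∀ y → y ≤ ρ q ^ suc n ^ℝ fromℚ s → y ℚ.≤ w
    y≤w y y≤ = ^-cancelˡ-≤ b (^≥0 (m ℕ.* suc b) 0≤ρ) (begin
      y ^ b                          ≤⟨ y≤ (suc b) b (inj₁ (ρ≤1ℚ , b+1/b<s)) ⟩
      (ρ q ^ suc n) ^ suc b          ≡⟨ ^-assocʳ (ρ q) (suc n) (suc b) ⟩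
      ρ q ^ (suc n ℕ.* suc b)        ≡⟨ cong (ρ q ^_) (lem k m′) ⟩
      ρ q ^ (m ℕ.* suc b ℕ.* b)      ≡⟨ ^-assocʳ (ρ q) (m ℕ.* suc b) b ⟨
      w ^ b                          ∎)
      where
      lem : ∀ k m′ → suc (m′ ℕ.+ k ℕ.* suc m′) ℕ.* suc (suc k) ≡ suc m′ ℕ.* suc (suc k) ℕ.* suc k
      lem = solve-∀

    y≤0 : ∀ y → y ≤ 0ℚ ^ℝ fromℚ s → y ℚ.≤ 0ℚ
    y≤0 y y≤ = ^-cancelˡ-≤ b ℚ.≤-refl (begin
      y ^ b        ≤⟨ y≤ (suc b) b (inj₁ (ℚ.nonNegative⁻¹ 1ℚ , b+1/b<s)) ⟩
      0ℚ ^ suc b   ≡⟨ 0^n≡0 (suc b) ⟩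
      0ℚ           ≡⟨ 0^n≡0 b ⟨
      0ℚ ^ b       ∎)

    qⁿw≤η : ι (q ℕ.^ n) ℚ.* w ℚ.≤ η
    qⁿw≤η = begin
      ι (q ℕ.^ n) ℚ.* w                          ≡⟨ cong₂ ℚ._*_ (ι-^ q n) (trans (cong (ρ q ^_) (lem k m′)) (^-homo-* (ρ q) n (suc m))) ⟩
      ι q ^ n ℚ.* (ρ q ^ n ℚ.* ρ q ^ suc m)      ≡⟨ solve 3 (λ i r x → i :* (r :* x) := (r :* i) :* x) refl (ι q ^ n) (ρ q ^ n) (ρ q ^ suc m) ⟩
      ρ q ^ n ℚ.* ι q ^ n ℚ.* ρ q ^ suc m        ≡⟨ cong (ℚ._* ρ q ^ suc m) (^-inverse (ρ q) (ι q) n (ρ*ι≡1 q)) ⟩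
      1ℚ ℚ.* ρ q ^ suc m                         ≡⟨ ℚ.*-identityˡ _ ⟩
      ρ q ^ suc m                                ≤⟨ ρ^-anti {proj₁ m₂} {suc m} (ℕ.≤-trans (ℕ.m≤n⊔m (proj₁ m₁) (proj₁ m₂)) (ℕ.m≤n+m m′ 2)) ⟩
      ρ q ^ proj₁ m₂                             ≤⟨ proj₂ m₂ ⟩
      η                                          ∎
      where
      open +-*-Solver
      lem : ∀ k m′ → suc m′ ℕ.* suc (suc k) ≡ m′ ℕ.+ k ℕ.* suc m′ ℕ.+ suc (suc m′)
      lem = solve-∀

-- Lower bound: M is not null in any dimension below 1

½<1 : ½ ℚ.< 1ℚ
½<1 = /-mono-< (+ 1) (+ 1) 2 1 (ℤ.+<+ (s≤s (s≤s z≤n)))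

-- With roots, this is γ^m ≤ r^(mp/b) ≤ r^(ma/c) ≤ d^(a/c), using a/c ≤ p/b and r ≤ 1; comparing
-- b-th powers removes the roots.
^-compare : ∀ {γ r d} p b .{{_ : ℕ.NonZero b}} → 0ℚ ℚ.≤ γ → 0ℚ ℚ.≤ r → r ℚ.≤ 1ℚ → γ ^ b ℚ.≤ r ^ p →
  ∀ m a c → r ^ m ℚ.≤ d → a ℕ.* b ℕ.≤ p ℕ.* c → (γ ^ m) ^ c ℚ.≤ d ^ a
^-compare {γ} {r} {d} p b 0≤γ 0≤r r≤1 γᵇ≤rᵖ m a c rᵐ≤d ab≤pc = ^-cancelˡ-≤ b (^≥0 a 0≤d) (begin
  ((γ ^ m) ^ c) ^ b        ≡⟨ trans (cong (_^ b) (^-assocʳ γ m c)) (^-assocʳ γ (m ℕ.* c) b) ⟩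
  γ ^ (m ℕ.* c ℕ.* b)      ≡⟨ cong (γ ^_) (ℕ.*-comm (m ℕ.* c) b) ⟩
  γ ^ (b ℕ.* (m ℕ.* c))    ≡⟨ ^-assocʳ γ b (m ℕ.* c) ⟨
  (γ ^ b) ^ (m ℕ.* c)      ≤⟨ ^-monoˡ-≤ (m ℕ.* c) (^≥0 b 0≤γ) γᵇ≤rᵖ ⟩
  (r ^ p) ^ (m ℕ.* c)      ≡⟨ ^-assocʳ r p (m ℕ.* c) ⟩
  r ^ (p ℕ.* (m ℕ.* c))    ≤⟨ ^-anti-≤ {r} {m ℕ.* (a ℕ.* b)} {p ℕ.* (m ℕ.* c)} 0≤r r≤1 exponents ⟩
  r ^ (m ℕ.* (a ℕ.* b))    ≡⟨ ^-assocʳ r m (a ℕ.* b) ⟨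
  (r ^ m) ^ (a ℕ.* b)      ≤⟨ ^-monoˡ-≤ (a ℕ.* b) (^≥0 m 0≤r) rᵐ≤d ⟩
  d ^ (a ℕ.* b)            ≡⟨ ^-assocʳ d a b ⟨
  (d ^ a) ^ b              ∎)
  where
  open ℚ.≤-Reasoning
  0≤d : 0ℚ ℚ.≤ d
  0≤d = ℚ.≤-trans (^≥0 m 0≤r) rᵐ≤d
  exponents : m ℕ.* (a ℕ.* b) ℕ.≤ p ℕ.* (m ℕ.* c)
  exponents = ℕ.≤-trans (ℕ.*-monoʳ-≤ m ab≤pc) (ℕ.≤-reflexive (lem m p c))
    where
    lem : ∀ m k c → m ℕ.* (k ℕ.* c) ≡ k ℕ.* (m ℕ.* c)
    lem = solve-∀

module Lower {q : ℕ} (F : FiniteField q) (em : ExcludedMiddle 0ℓ)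
  {γ ε : ℚ} (γ>0 : 0ℚ ℚ.< γ) (ε+½<1 : ε ℚ.+ ½ ℚ.< 1ℚ)
  (ε+½≤γq½ : ε ℚ.+ ½ ℚ.≤ γ ℚ.* (ι q ℚ.* ½))
  (ℓ : ℕ → ℕ) (ℓ-large : ∀ n → ι (2 ℕ.+ n) ℚ.* γ ^ ℓ n ℚ.≤ ε)
  (D : ℕ) .{{D≢0 : ℕ.NonZero D}} (ℓ-small : ∀ n → q ℕ.^ ℓ n ℕ.≤ (D ℕ.* (2 ℕ.+ n)) ℕ.^ 2)
  (k : ℕ) (γ^-≤ρ^ : γ ^ suc (suc k) ℚ.≤ ρ q {{FiniteField.q≢0 F}} ^ suc k)
  where
  open Polynomials F em
  open Laurent F em
  open Greedy em q γ>0
  open Construction F em γ>0 ε+½<1 ε+½≤γq½ ℓ ℓ-large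
  private
    module F = FiniteField F
    A = Fin q
    Word = List A
    b : ℕ
    b = suc (suc k)
    0≤γ = ℚ.<⇒≤ γ>0

  Θ⟨_⟩ : (ℕ → A) → 𝕃
  Θ⟨ x ⟩ = series (from ∘ x)

  module _ (s : ℝ) (s<σ : above s (+ suc k / b)) where

    -- A set with q^-(m+1) ≤ d < q^-m fixes only m digits, while d is bounded below by q^-(m+1). The
    -- extra factor γ pays for the missing digit.
    γ^-≤-^ℝ : ∀ m {d} → ρ q ^ suc m ℚ.≤ d → d ℚ.< 1ℚ → (γ ℚ.* γ ^ m) ≤ d ^ℝ s
    γ^-≤-^ℝ m {d} ρ≤d d<1 a c (inj₂ (1≤d , _)) = ⊥-elim (ℚ.<-irrefl refl (ℚ.<-≤-trans d<1 1≤d))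
    γ^-≤-^ℝ m {d} ρ≤d d<1 a c (inj₁ (_ , a/c<s)) =
      ^-compare (suc k) (suc (suc k)) 0≤γ 0≤ρ (ρ≤1 q) γ^-≤ρ^ (suc m) a c ρ≤d ab≤
      where
      ab≤ : a ℕ.* b ℕ.≤ suc k ℕ.* c
      ab≤ = ℕ.<⇒≤ (ℤ.drop‿+<+ (subst₂ ℤ._<_ (sym (ℤ.pos-* a b)) (sym (ℤ.pos-* (suc k) c))
        (/-cancel-< (+ a) (+ suc k) c b (below-above-< s a/c<s s<σ))))

    0≤-^ℝ : ∀ {d} → 0ℚ ℚ.≤ d → 0ℚ ≤ d ^ℝ s
    0≤-^ℝ 0≤d a c _ = ℚ.≤-trans (ℚ.≤-reflexive (0^n≡0 c)) (^≥0 a 0≤d)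

    -- How to avoid a set U of diameter d: as a single point if d = 0, and
    -- through a prefix whose weight is comparable to d ^ s otherwise.
    record Avoidance (U : 𝕃 → Set) (d : ℚ) : Set where
      field
        point   : ℕ → A
        words   : List Word
        cheap   : (γ ℚ.* Φ words) ≤ d ^ℝ s
        capture : ∀ x → U Θ⟨ x ⟩ → (∀ i → point i ≡ x i) ⊎ (∃[ m ] seg x 0 m ∈ words)

    module _ {U : 𝕃 → Set} {d : ℚ} (0≤d : 0ℚ ℚ.≤ d) (∣U∣≤d : ∀ Θ Φ → U Θ → U Φ → ∣ Θ ⊖ Φ ∣ ℚ.≤ d) where

      cheap-[] : (γ ℚ.* Φ []) ≤ d ^ℝ s
      cheap-[] = subst (λ y → y ≤ d ^ℝ s) (sym (ℚ.*-zeroʳ γ)) (0≤-^ℝ 0≤d)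

      avoid-∅ : ¬ (∃[ x ] U Θ⟨ x ⟩) → Avoidance U d
      avoid-∅ ¬∃ = record
        -- An arbitrary point, since there is nothing to capture.
        { point = λ _ → Inverse.to F.enumeration F.0#
        ; words = []
        ; cheap = cheap-[]
        ; capture = λ x Ux → ⊥-elim (¬∃ (x , Ux)) }

      avoid-point : ∀ x → U Θ⟨ x ⟩ → d ℚ.≤ 0ℚ → Avoidance U d
      avoid-point x Ux d≤0 = record
        { point = x
        ; words = []
        ; cheap = cheap-[]
        ; capture = λ y Uy → inj₁ λ i → agree x y (suc i) (∣U∣≤d Θ⟨ x ⟩ Θ⟨ y ⟩ Ux Uy)
            (ℚ.≤-<-trans d≤0 (^>0 (suc i) (ρ>0 q))) i ℕ.≤-refl }

      avoid-prefix : ∀ x → U Θ⟨ x ⟩ → d ℚ.< 1ℚ → ∀ m → ρ q ^ suc m ℚ.≤ d → d ℚ.< ρ q ^ m → Avoidance U d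
      avoid-prefix x Ux d<1 m ρ≤d d<ρ = record
        { point = x
        ; words = seg x 0 m ∷ []
        ; cheap = subst (λ y → y ≤ d ^ℝ s) (cong (γ ℚ.*_) (sym Φ≡)) (γ^-≤-^ℝ m ρ≤d d<1)
        ; capture = λ y Uy → inj₂ (m , here (sym (seg-cong 0 m (agree x y m (∣U∣≤d Θ⟨ x ⟩ Θ⟨ y ⟩ Ux Uy) d<ρ)))) }
        where
        Φ≡ : Φ (seg x 0 m ∷ []) ≡ γ ^ m
        Φ≡ = trans (ℚ.+-identityʳ (γ ^ length (seg x 0 m))) (cong (γ ^_) (length-seg x 0 m))

    avoidance : ∀ {U d} → IsDiameter U d → d ℚ.≤ ½ → Avoidance U d
    avoidance {U} {d} ((0≤d , ∣U∣≤d) , _) d≤½ with em {∃[ x ] U Θ⟨ x ⟩} | 0ℚ ℚ.<? d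
    ... | no ¬∃        | _      = avoid-∅ 0≤d ∣U∣≤d ¬∃
    ... | yes (x , Ux) | no d≯0 = avoid-point 0≤d ∣U∣≤d x Ux (ℚ.≮⇒≥ d≯0)
    ... | yes (x , Ux) | yes 0<d =
      let d<1 = ℚ.≤-<-trans d≤½ ½<1
          m , ρ≤d , d<ρ = ∃-ρ^-approx q 2≤q d 0<d d<1
      in avoid-prefix 0≤d ∣U∣≤d x Ux d<1 m ρ≤d d<ρ

    no-cheap-cover : ∀ {U d} → IsCover ½ (M log²) U d → ¬ (∑ d ^ℝ s ≤ (γ ℚ.* ½))
    no-cheap-cover {U} {d} cover ∑≤ =
      escape {points i} {words i} (proj₁ (proj₂ (proj₂ constructed)) i) (proj₂ (proj₂ (proj₂ constructed)) i)
        (Avoidance.capture (avoid i) x (proj₂ captured))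
      where
      open IsCover cover

      avoid : ∀ i → Avoidance (U i) (d i)
      avoid i = avoidance (diameter i) (fine i)

      points : ℕ → ℕ → A
      points i = Avoidance.point (avoid i)

      words : ℕ → List Word
      words i = Avoidance.words (avoid i)

      total≤½ : ∀ n → total words n ℚ.≤ ½
      total≤½ n = ℚ.*-cancelˡ-≤-pos γ {{ℚ.positive γ>0}} (ℚ.≤-trans
        (ℚ.≤-reflexive (ℚ∑.*-distribˡ-sum {n} γ (λ i → Φ (words (toℕ i)))))
        (∑≤ n (λ i → γ ℚ.* Φ (words (toℕ i))) (λ i → *≥0 0≤γ (Φ≥0 (words (toℕ i))) , Avoidance.cheap (avoid (toℕ i)))))

      constructed = construct points words total≤½

      x : ℕ → A
      x = proj₁ constructed

      captured : ∃[ i ] U i Θ⟨ x ⟩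
      captured = covers Θ⟨ x ⟩ (¬recurrent⇒∈M D ℓ ℓ-small (from ∘ x) (proj₁ (proj₂ constructed)))

      i : ℕ
      i = proj₁ captured

      escape : ∀ {p ws} → ¬ (∀ i → p i ≡ x i) → (∀ {v} → v ∈ ws → v ≢ seg x 0 (length v)) →
        ¬ ((∀ i → p i ≡ x i) ⊎ (∃[ m ] seg x 0 m ∈ ws))
      escape ¬point ¬word (inj₁ same)      = ¬point same
      escape ¬point ¬word (inj₂ (m , ∈ws)) = ¬word ∈ws (cong (seg x 0) (sym (length-seg x 0 m)))

    M-not-null : ¬ (Hausdorff[ s ] (M log²) ≤ 0ℚ)
    -- δ = ½ keeps all diameters below 1, as the choice of prefixes requires. The bound γ · ½ on the
    -- sum becomes the bound ½ on the potential, because each set contributes γ times the weight of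
    -- its words.
    M-not-null null = let U , d , cover , ∑≤ = null ½ (/>0 1 2) (γ ℚ.* ½) (*>0 γ>0 (/>0 1 2)) in no-cheap-cover cover ∑≤

-- The dimension as an infimum of exponents

theorem1p1p4 : (em : ExcludedMiddle 0ℓ) (q : ℕ) → IsPrimePower q → (F : FiniteField q) →
    let open Laurent F em in HausdorffDimension (M log²) 1ℝ
theorem1p1p4 em q _ F = lower , upper
  where
  open Laurent F em
  open Norm F em using (2≤q; q≢0)

  lower : ∀ s → 0ℝ <ℝ s × (Hausdorff[ s ] (M log²) ≤ 0ℚ) → 1ℝ ≤ℝ s
  lower s (_ , null) r r<1 with em {below s r}
  ... | yes r<s = r<s
  ... | no  r≮s = ⊥-elim (M-not-null s s<σ null)
    where
    k = proj₁ (<1⇒<d/[1+d] r r<1)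
    -- Then u + 1 = 2(k + 2), the least value for which `γ^-≤` yields γ^(k+2) ≤ q^-(k+1).
    u = suc (2 ℕ.* suc k)

    s<σ : above s (+ suc k / suc (suc k))
    -- Since r is not below s, locatedness puts s below σ = (k+1)/(k+2) < 1, where M is not null.
    s<σ with located s r (+ suc k / suc (suc k)) (proj₂ (<1⇒<d/[1+d] r r<1))
    ... | inj₁ r<s = ⊥-elim (r≮s r<s)
    ... | inj₂ s<σ = s<σ

    open Rate q 2≤q u (s≤s (ℕ.*-monoʳ-≤ 2 (s≤s z≤n)))
    D = 2 ℕ.* u ℕ.* q
    instance
      D≢0 : ℕ.NonZero D
      D≢0 = ℕ.m*n≢0 (2 ℕ.* u) q
    open Lower F em γ>0 ε+½<1 ε+½≤γq½
      (λ n → proj₁ (∃-length n)) (λ n → proj₁ (proj₂ (∃-length n)))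
      D (λ n → proj₂ (proj₂ (∃-length n)))
      k (γ^-≤ (suc k) (ℕ.≤-reflexive (ℕ.*-suc 2 (suc k))))

  upper : ∀ y → (∀ s → 0ℝ <ℝ s × (Hausdorff[ s ] (M log²) ≤ 0ℚ) → y ≤ℝ s) → y ≤ℝ 1ℝ
  upper y y≤ r r<y = ℚ.≰⇒> λ 1≤r →
    -- If y exceeded 1, a rational r′ strictly between 1 and y would be an admissible exponent,
    -- forcing y ≤ r′.
    let r′ , r<r′ , r′<y = Equivalence.to (below-rounded y r) r<y
        1<r′ = ℚ.≤-<-trans 1≤r r<r′
    in ℚ.<-irrefl refl (y≤ (fromℚ r′)
      ((½ , />0 1 2 , ℚ.<-trans ½<1 1<r′) , Upper.𝕀-null F em (M log²) (λ _ → proj₁) r′ 1<r′) r′ r′<y)
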